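{- The brute force algorithm (described in the context) computes the values of $\Vert n\Vert$ for $1\le n\le N$ in time $O(N^2)$ and space $O(N\log^2 N)$.
   Context: For a positive integer $n$, the complexity $\Vert n\Vert$ is the least number of $1$'s needed to express $n$ using only $+$, $\times$ and parentheses. Thus $\Vert 1\Vert=1$ and for $n\ge2$, $\Vert n\Vert$ is the minimum of $\Vert a\Vert+\Vert b\Vert$ over positive integers $a,b<n$ with $a+b=n$ or $ab=n$. Time is the number of elementary operations (arithmetic operations and comparisons on integers, reads and writes of array entries); space is measured in bits. Brute force algorithm, with input $N$. First, a list of all the divisors of every $n\le N$ is built and stored: each list starts as $(1)$, and for $k=2,\dots,N$, $k$ is appended to the list of every multiple $m\le N$ of $k$. Put $\mathrm{Compl}[1]=1$. Then for $n=2,\dots,N$ in increasing order compute $$S=\min_{1\le k\le n/2}\bigl(\mathrm{Compl}[k]+\mathrm{Compl}[n-k]\bigr),\qquad P=\min_{d\mid n,\ 1<d<n}\bigl(\mathrm{Compl}[d]+\mathrm{Compl}[n/d]\bigr)$$ by running over all $k$ and over all stored divisors $d$ of $n$ respectively (with $P=N+1$ if $n$ is prime), and put $\mathrm{Compl}[n]=\min(S,P)$. The output is $\mathrm{Compl}[n]=\Vert n\Vert$ for $1\le n\le N$. -}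

module Defs where

open import Data.Bool using (if_then_else_)
open import Data.Fin using (Fin; #_)
open import Data.List using (upTo)
open import Data.Nat
  using (ℕ; zero; suc; _+_; _*_; _∸_; _/_; _≡ᵇ_; _≤_; _≰_; _⊔_)
open import Data.Nat.Logarithm using (⌊log₂_⌋)
open import Data.Product using (_×_; ∃-syntax)
open import Data.Vec using (Vec; replicate; lookup; _[_]≔_)
open import Relation.Binary.PropositionalEquality using (_≡_)
import Data.List as List
import Data.Nat.ListAction as ℕList
import Data.Vec as Vec

infixl 6 _⊕_
infixl 7 _⊗_

data OnesExpr : Set where
  𝟙       : OnesExpr
  _⊕_ _⊗_ : OnesExpr → OnesExpr → OnesExpr

value : OnesExpr → ℕ
value 𝟙       = 1
value (e ⊕ f) = value e + value f
value (e ⊗ f) = value e * value f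

ones : OnesExpr → ℕ
ones 𝟙       = 1
ones (e ⊕ f) = ones e + ones f
ones (e ⊗ f) = ones e + ones f

infix 4 ‖_‖≡_

‖_‖≡_ : ℕ → ℕ → Set
‖ n ‖≡ c =
  (∃[ e ] value e ≡ n × ones e ≡ c) × (∀ e → value e ≡ n → c ≤ ones e)

infix 4 _∈O_

_∈O_ : (ℕ → ℕ) → (ℕ → ℕ) → Set
f ∈O g = ∃[ C ] ∃[ N₀ ] (∀ N → N₀ ≤ N → f N ≤ C * g N)

bits : ℕ → ℕ
bits v = suc ⌊log₂ v ⌋

-- An array starts out empty and occupies the cells below `extent`: writing
-- to cell i makes it occupy all cells up to i (the ones never written hold 0).

record Array : Set where
  constructor array
  field
    extent : ℕ
    cell   : ℕ → ℕ

open Array public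

emptyArray : Array
emptyArray = array 0 (λ _ → 0)

writeCell : ℕ → ℕ → Array → Array
writeCell i v (array l f) =
  array (l ⊔ suc i) (λ j → if i ≡ᵇ j then v else f j)

arraySize : Array → ℕ
arraySize a = ℕList.sum (List.map (λ i → bits (cell a i)) (upTo (extent a)))

Var Arr : Set
Var = Fin 10
Arr = Fin 4

record State : Set where
  constructor state
  field
    vars   : Vec ℕ 10
    arrays : Vec Array 4

open State public

stateSize : State → ℕ
stateSize s =
  Vec.sum (Vec.map bits (vars s)) + Vec.sum (Vec.map arraySize (arrays s))

infix  9 !_ _[_]
infixl 7 _/ᵉ_
infixl 6 _+ᵉ_ _-ᵉ_

data Expr : Set where
  lit            : ℕ → Expr
  !_             : Var → Expr
  _[_]           : Arr → Expr → Expr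
  _+ᵉ_ _-ᵉ_ _/ᵉ_ : Expr → Expr → Expr

-- Made total by x / 0 = 0; the algorithm below never divides by 0.

quotient : ℕ → ℕ → ℕ
quotient m zero    = 0
quotient m (suc d) = m / suc d

⟦_⟧ : Expr → State → ℕ
⟦ lit c ⟧    s = c
⟦ ! x ⟧      s = lookup (vars s) x
⟦ a [ e ] ⟧  s = cell (lookup (arrays s) a) (⟦ e ⟧ s)
⟦ e +ᵉ f ⟧  s = ⟦ e ⟧ s + ⟦ f ⟧ s
⟦ e -ᵉ f ⟧  s = ⟦ e ⟧ s ∸ ⟦ f ⟧ s
⟦ e /ᵉ f ⟧  s = quotient (⟦ e ⟧ s) (⟦ f ⟧ s)

-- Accesses to variables are charged like accesses to array entries.

cost : Expr → ℕ
cost (lit c)    = 0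
cost (! x)      = 1
cost (a [ e ])  = suc (cost e)
cost (e +ᵉ f)   = suc (cost e + cost f)
cost (e -ᵉ f)   = suc (cost e + cost f)
cost (e /ᵉ f)   = suc (cost e + cost f)

-- Bits needed to hold the values of all subexpressions simultaneously.

scratch : Expr → State → ℕ
scratch e@(lit _)    s = bits (⟦ e ⟧ s)
scratch e@(! _)      s = bits (⟦ e ⟧ s)
scratch e@(_ [ f ])  s = bits (⟦ e ⟧ s) + scratch f s
scratch e@(f +ᵉ g)  s = bits (⟦ e ⟧ s) + (scratch f s + scratch g s)
scratch e@(f -ᵉ g)  s = bits (⟦ e ⟧ s) + (scratch f s + scratch g s)
scratch e@(f /ᵉ g)  s = bits (⟦ e ⟧ s) + (scratch f s + scratch g s)

infix  5 _≔_ _[_]≔ᵃ_ _⩽_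
infix  4 If_Then_Else_ While_Do_
infixr 3 _⨾_

data Test : Set where
  _⩽_ : Expr → Expr → Test

data Cmd : Set where
  Skip          : Cmd
  _≔_           : Var → Expr → Cmd
  _[_]≔ᵃ_       : Arr → Expr → Expr → Cmd
  _⨾_           : Cmd → Cmd → Cmd
  If_Then_Else_ : Test → Cmd → Cmd → Cmd
  While_Do_     : Test → Cmd → Cmd

assignVar : Var → ℕ → State → State
assignVar x v s = record s { vars = vars s [ x ]≔ v }

assignCell : Arr → ℕ → ℕ → State → State
assignCell a i v s =
  record s { arrays = arrays s [ a ]≔ writeCell i v (lookup (arrays s) a) }

True False : Test → State → Set
True  (e ⩽ f) s = ⟦ e ⟧ s ≤ ⟦ f ⟧ s
False (e ⩽ f) s = ⟦ e ⟧ s ≰ ⟦ f ⟧ s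

testCost : Test → ℕ
testCost (e ⩽ f) = suc (cost e + cost f)

testSpace : Test → State → ℕ
testSpace (e ⩽ f) s = stateSize s + (scratch e s + scratch f s)

-- ⟨ c , s ⟩⇓⟨ s′ , t , b ⟩ : started in s, the command c terminates in s′
-- after t elementary operations, with at most b bits in use at any moment
-- and exactly b bits at some moment.

infix 2 ⟨_,_⟩⇓⟨_,_,_⟩

data ⟨_,_⟩⇓⟨_,_,_⟩ : Cmd → State → State → ℕ → ℕ → Set where

  ⇓skip : ∀ {s} → ⟨ Skip , s ⟩⇓⟨ s , 0 , stateSize s ⟩

  ⇓assign : ∀ {x e s} →
    let s′ = assignVar x (⟦ e ⟧ s) s in
    ⟨ x ≔ e , s ⟩⇓⟨ s′ , suc (cost e) ,
                    (stateSize s + scratch e s) ⊔ stateSize s′ ⟩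

  ⇓write : ∀ {a i e s} →
    let s′ = assignCell a (⟦ i ⟧ s) (⟦ e ⟧ s) s in
    ⟨ a [ i ]≔ᵃ e , s ⟩⇓⟨ s′ , suc (cost i + cost e) ,
      (stateSize s + (scratch i s + scratch e s)) ⊔ stateSize s′ ⟩

  ⇓seq : ∀ {c₁ c₂ s₀ s₁ s₂ t₁ t₂ b₁ b₂} →
    ⟨ c₁ , s₀ ⟩⇓⟨ s₁ , t₁ , b₁ ⟩ →
    ⟨ c₂ , s₁ ⟩⇓⟨ s₂ , t₂ , b₂ ⟩ →
    ⟨ c₁ ⨾ c₂ , s₀ ⟩⇓⟨ s₂ , t₁ + t₂ , b₁ ⊔ b₂ ⟩

  ⇓then : ∀ {p c₁ c₂ s s′ t b} →
    True p s →
    ⟨ c₁ , s ⟩⇓⟨ s′ , t , b ⟩ →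
    ⟨ If p Then c₁ Else c₂ , s ⟩⇓⟨ s′ , testCost p + t , testSpace p s ⊔ b ⟩

  ⇓else : ∀ {p c₁ c₂ s s′ t b} →
    False p s →
    ⟨ c₂ , s ⟩⇓⟨ s′ , t , b ⟩ →
    ⟨ If p Then c₁ Else c₂ , s ⟩⇓⟨ s′ , testCost p + t , testSpace p s ⊔ b ⟩

  ⇓exit : ∀ {p c s} →
    False p s →
    ⟨ While p Do c , s ⟩⇓⟨ s , testCost p , testSpace p s ⟩

  ⇓loop : ∀ {p c s₀ s₁ s₂ t₁ t₂ b₁ b₂} →
    True p s₀ →
    ⟨ c , s₀ ⟩⇓⟨ s₁ , t₁ , b₁ ⟩ →
    ⟨ While p Do c , s₁ ⟩⇓⟨ s₂ , t₂ , b₂ ⟩ →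
    ⟨ While p Do c , s₀ ⟩⇓⟨ s₂ , testCost p + (t₁ + t₂) ,
                             testSpace p s₀ ⊔ (b₁ ⊔ b₂) ⟩

module BruteForce where

  N n k m d p free S P c : Var
  N    = # 0
  n    = # 1
  k    = # 2
  m    = # 3
  d    = # 4
  p    = # 5
  free = # 6
  S    = # 7
  P    = # 8
  c    = # 9

  -- The divisor lists are linked lists of nodes numbered from 1: node i
  -- holds the divisor `val [ i ]` and is followed by node `next [ i ]`,
  -- where 0 marks the end.  The list of n begins at node n and ends at node
  -- `lastOf [ n ]`; the nodes from `free` on are unused.

  compl val next lastOf : Arr
  compl  = # 0
  val    = # 1
  next   = # 2
  lastOf = # 3

  startLists : Cmd
  startLists =
    n ≔ lit 1 ⨾
    (While ! n ⩽ ! N Do (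
      val    [ ! n ]≔ᵃ lit 1 ⨾
      next   [ ! n ]≔ᵃ lit 0 ⨾
      lastOf [ ! n ]≔ᵃ ! n ⨾
      n ≔ ! n +ᵉ lit 1)) ⨾
    free ≔ ! N +ᵉ lit 1

  append-k-to-list-m : Cmd
  append-k-to-list-m =
    val    [ ! free ]≔ᵃ ! k ⨾
    next   [ ! free ]≔ᵃ lit 0 ⨾
    next   [ lastOf [ ! m ] ]≔ᵃ ! free ⨾
    lastOf [ ! m ]≔ᵃ ! free ⨾
    free ≔ ! free +ᵉ lit 1

  buildDivisorLists : Cmd
  buildDivisorLists =
    startLists ⨾
    k ≔ lit 2 ⨾
    (While ! k ⩽ ! N Do (
      m ≔ ! k ⨾
      (While ! m ⩽ ! N Do (
        append-k-to-list-m ⨾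
        m ≔ ! m +ᵉ ! k)) ⨾
      k ≔ ! k +ᵉ lit 1))

  -- The initial value N + 1 of S, and of P when n is composite, does not
  -- affect the minimum: each sum is at most n, because ‖ j ‖ ≤ j and
  -- d + n / d ≤ n for proper divisors d > 1.

  computeS : Cmd
  computeS =
    S ≔ ! N +ᵉ lit 1 ⨾
    k ≔ lit 1 ⨾
    (While ! k ⩽ ! n /ᵉ lit 2 Do (
      c ≔ compl [ ! k ] +ᵉ compl [ ! n -ᵉ ! k ] ⨾
      (If ! c ⩽ ! S Then S ≔ ! c Else Skip) ⨾
      k ≔ ! k +ᵉ lit 1))

  computeP : Cmd
  computeP =
    P ≔ ! N +ᵉ lit 1 ⨾
    p ≔ ! n ⨾
    (While lit 1 ⩽ ! p Do (
      d ≔ val [ ! p ] ⨾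
      (If ! d ⩽ lit 1 Then Skip Else
       If ! n ⩽ ! d   Then Skip Else (
        c ≔ compl [ ! d ] +ᵉ compl [ ! n /ᵉ ! d ] ⨾
        (If ! c ⩽ ! P Then P ≔ ! c Else Skip))) ⨾
      p ≔ next [ ! p ]))

  computeComplexities : Cmd
  computeComplexities =
    compl [ lit 1 ]≔ᵃ lit 1 ⨾
    n ≔ lit 2 ⨾
    (While ! n ⩽ ! N Do (
      computeS ⨾
      computeP ⨾
      (If ! S ⩽ ! P Then compl [ ! n ]≔ᵃ ! S Else compl [ ! n ]≔ᵃ ! P) ⨾
      n ≔ ! n +ᵉ lit 1))

  bruteForce : Cmd
  bruteForce = buildDivisorLists ⨾ computeComplexities

  initial : ℕ → State
  initial x = assignVar N x (state (replicate 10 0) (replicate 4 emptyArray))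

  Compl : State → ℕ → ℕ
  Compl s = cell (lookup (arrays s) compl)

open BruteForce public using (bruteForce; initial; Compl)

{-# OPTIONS --safe #-}
-- A run in which all variables, array entries and array extents stay at most W
-- uses O(W log W) bits, so the space bound reduces to finding W = O(N log N).
-- The number of list nodes is Σ_{k ≤ N} ⌊N / k⌋, and each of the ⌊log₂ N⌋ + 1
-- dyadic blocks of k contributes at most N to it.  The values along a list
-- increase, so every list of divisors of n has at most n nodes and each n takes
-- O(N) operations.  The minimum computed for n is ‖ n ‖ because, up to factors 1,
-- the outermost operation of an expression for n splits it into smaller numbers.

module Submission where

open import Defs
open import Data.Bool using (true; false; T; if_then_else_)
open import Data.Empty using (⊥-elim)
open import Data.Fin using (zero; suc; #_)
open import Data.List using ([]; _∷_; length; upTo)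
open import Data.List.Properties using (length-upTo)
open import Data.Nat
open import Data.Nat.DivMod
open import Data.Nat.Divisibility hiding (quotient)
open import Data.Nat.Logarithm using (⌊log₂_⌋; ⌊log₂⌋-mono-≤; ⌊log₂[2^n]⌋≡n)
open import Data.Nat.Properties
open import Data.Nat.Solver using (module +-*-Solver)
open import Data.Product using (Σ; _×_; _,_; proj₁; proj₂; ∃-syntax)
open import Data.Sum using (_⊎_; inj₁; inj₂)
open import Data.Unit using (tt)
open import Data.Vec using (Vec; []; _∷_; lookup; _[_]≔_)
open import Data.Vec.Relation.Unary.All as All using (All; []; _∷_)
open import Data.Vec.Relation.Unary.All.Properties using (lookup⁺)
open import Relation.Binary.PropositionalEquality hiding ([_])
open import Relation.Binary.Definitions using (tri<; tri≈; tri>)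
open import Relation.Nullary using (¬_; yes; no; contradiction)
import Data.List as List
import Data.Nat.ListAction as ℕList
import Data.Vec as Vec

-- The semantics fixes the exact time and peak space of a run, so termination, both bounds and
-- correctness are derived together: a `Run` yields a derivation along with all of them.
-- Intermediate results may exceed W, but an expression of bounded size keeps them within a fixed
-- multiple of W, which lengthens a word only by a constant. Each loop invariant carries a number j
-- that bounds the remaining iterations; this gives termination and the time bound at once, and in
-- the loop over multiples it also reserves the nodes still to be created. The obstacle is the
-- divisor lists: all of them share the same arrays, so an append must be shown to leave the other
-- lists intact.

-- Function updates and integer division.

update : ℕ → ℕ → (ℕ → ℕ) → ℕ → ℕ
update i v f j = if i ≡ᵇ j then v else f j

update-same : ∀ i v f → update i v f i ≡ v
update-same i v f with i ≡ᵇ i | ≡⇒≡ᵇ i i refl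
... | true | _ = refl

update-other : ∀ {i j} v f → j ≢ i → update i v f j ≡ f j
update-other {i} {j} v f j≢i with i ≡ᵇ j | ≡ᵇ⇒≡ i j
... | true  | i≡j = contradiction (sym (i≡j tt)) j≢i
... | false | _   = refl

quotient-≤ : ∀ m n → quotient m n ≤ m
quotient-≤ m zero    = z≤n
quotient-≤ m (suc d) = m/n≤m m (suc d)

quotient-antitone : ∀ m {i j} → 1 ≤ i → i ≤ j → quotient m j ≤ quotient m i
quotient-antitone m {suc i} {suc j} _ i≤j = /-monoʳ-≤ m i≤j

quotient-cofactor : ∀ a b → 1 ≤ a → quotient (a * b) a ≡ b
quotient-cofactor (suc a) b _ =
  trans (cong (_/ suc a) (*-comm (suc a) b)) (m*n/n≡m b (suc a))

*-quotient : ∀ a n → 1 ≤ a → a ∣ n → a * quotient n a ≡ n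
*-quotient a n 1≤a (divides b refl) rewrite *-comm b a =
  cong (a *_) (quotient-cofactor a b 1≤a)

*-quotient-≤ : ∀ a n → a * quotient n a ≤ n
*-quotient-≤ zero    n = z≤n
*-quotient-≤ (suc a) n rewrite *-comm (suc a) (n / suc a) = m/n*n≤m n (suc a)

-- Shows that `quotient n k` steps of length `k`, starting from `k`, lead past `n`; this is the
-- iteration count of the loop over multiples.
n<k+n/k*k : ∀ n k → 1 ≤ k → n < k + quotient n k * k
n<k+n/k*k n (suc k) _ = begin-strict
  n                                  ≡⟨ m≡m%n+[m/n]*n n (suc k) ⟩
  n % suc k + n / suc k * suc k      <⟨ +-monoˡ-< _ (m%n<n n (suc k)) ⟩
  suc k + n / suc k * suc k          ∎
  where open ≤-Reasoning

-- Harmonic sums and dyadic blocks.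

-- The upper end is exclusive and the index 0 contributes nothing, as `quotient` sends division by 0
-- to 0. Hence `harmonicSum N (suc N)` is the sum of ⌊N / k⌋ over 1 ≤ k ≤ N.
harmonicSum : ℕ → ℕ → ℕ
harmonicSum N zero    = 0
harmonicSum N (suc k) = harmonicSum N k + quotient N k

harmonicSum-mono : ∀ N {i j} → i ≤ j → harmonicSum N i ≤ harmonicSum N j
harmonicSum-mono N {i} {j} i≤j = subst (λ x → harmonicSum N i ≤ harmonicSum N x)
  (m+[n∸m]≡n i≤j) (go (j ∸ i))
  where
  go : ∀ b → harmonicSum N i ≤ harmonicSum N (i + b)
  go zero    rewrite +-identityʳ i = ≤-refl
  go (suc b) rewrite +-suc i b = ≤-trans (go b) (m≤m+n _ _)

harmonicSum-block : ∀ N a b → 1 ≤ a →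
  harmonicSum N (a + b) ≤ harmonicSum N a + b * quotient N a
harmonicSum-block N a zero    1≤a rewrite +-identityʳ a = m≤m+n _ _
harmonicSum-block N a (suc b) 1≤a rewrite +-suc a b = begin
  harmonicSum N (a + b) + quotient N (a + b)
    ≤⟨ +-mono-≤ (harmonicSum-block N a b 1≤a)
                (quotient-antitone N 1≤a (m≤m+n a b)) ⟩
  harmonicSum N a + b * quotient N a + quotient N a
    ≡⟨ +-assoc (harmonicSum N a) _ _ ⟩
  harmonicSum N a + (b * quotient N a + quotient N a)
    ≡⟨ cong (harmonicSum N a +_) (+-comm (b * quotient N a) _) ⟩
  harmonicSum N a + suc b * quotient N a ∎
  where open ≤-Reasoning

1≤2^ : ∀ i → 1 ≤ 2 ^ i
1≤2^ i = m^n>0 2 i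

-- Each dyadic block [2 ^ i, 2 ^ (i + 1)) contributes at most N.
harmonicSum-dyadic : ∀ N i → harmonicSum N (2 ^ i) ≤ i * N
harmonicSum-dyadic N zero    = z≤n
harmonicSum-dyadic N (suc i) = begin
  harmonicSum N (2 ^ i + (2 ^ i + 0))
    ≡⟨ cong (λ x → harmonicSum N (2 ^ i + x)) (+-identityʳ (2 ^ i)) ⟩
  harmonicSum N (2 ^ i + 2 ^ i)
    ≤⟨ harmonicSum-block N (2 ^ i) (2 ^ i) (1≤2^ i) ⟩
  harmonicSum N (2 ^ i) + 2 ^ i * quotient N (2 ^ i)
    ≤⟨ +-mono-≤ (harmonicSum-dyadic N i) (*-quotient-≤ (2 ^ i) N) ⟩
  i * N + N
    ≡⟨ +-comm (i * N) N ⟩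
  suc i * N ∎
  where open ≤-Reasoning

n<2^[1+log] : ∀ n → n < 2 ^ suc ⌊log₂ n ⌋
n<2^[1+log] n = ≰⇒> λ 2^≤n → <-irrefl refl
  (≤-trans (≤-reflexive (sym (⌊log₂[2^n]⌋≡n (suc ⌊log₂ n ⌋))))
           (⌊log₂⌋-mono-≤ 2^≤n))

harmonicSum-log : ∀ N → harmonicSum N (suc N) ≤ suc ⌊log₂ N ⌋ * N
harmonicSum-log N = ≤-trans (harmonicSum-mono N (n<2^[1+log] N))
                            (harmonicSum-dyadic N (suc ⌊log₂ N ⌋))

-- Integer complexity and its recursion.

value≥1 : ∀ e → 1 ≤ value e
value≥1 𝟙       = ≤-refl
value≥1 (e ⊕ f) = ≤-trans (value≥1 e) (m≤m+n _ _)
value≥1 (e ⊗ f) = *-mono-≤ (value≥1 e) (value≥1 f)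

ones≥1 : ∀ e → 1 ≤ ones e
ones≥1 𝟙       = ≤-refl
ones≥1 (e ⊕ f) = ≤-trans (ones≥1 e) (m≤m+n _ _)
ones≥1 (e ⊗ f) = ≤-trans (ones≥1 e) (m≤m+n _ _)

unary : ∀ n → 1 ≤ n → ∃[ e ] value e ≡ n × ones e ≡ n
unary (suc zero)    _ = 𝟙 , refl , refl
unary (suc (suc n)) _ with unary (suc n) (s≤s z≤n)
... | e , v , o = 𝟙 ⊕ e , cong suc v , cong suc o

-- Writing `n` as a sum of 1's uses `n` of them. This keeps table entries small and the default
-- value `suc N` out of reach of true complexities.
complexity-≤ : ∀ {n c} → 1 ≤ n → ‖ n ‖≡ c → c ≤ n
complexity-≤ {n} 1≤n (_ , minimal) with unary n 1≤n
... | e , v , o = ≤-trans (minimal e v) (≤-reflexive o)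

complexity-one : ‖ 1 ‖≡ 1
complexity-one = (𝟙 , refl , refl) , λ e _ → ones≥1 e

Table : (ℕ → ℕ) → ℕ → Set
Table T n = ∀ x → 1 ≤ x → x < n → ‖ x ‖≡ T x

-- Certifies that `v` is not merely a default value: optimal expressions for `a` and `b` combine to
-- an expression for `n` with `v` ones.
record Candidate (T : ℕ → ℕ) (n v : ℕ) : Set where
  constructor candidate
  field
    {a b}    : ℕ
    1≤a      : 1 ≤ a
    a<n      : a < n
    1≤b      : 1 ≤ b
    b<n      : b < n
    combines : a + b ≡ n ⊎ a * b ≡ n
    value≡   : v ≡ T a + T b

m<n*m : ∀ a b → 1 < a → 1 ≤ b → b < a * b
m<n*m a (suc b) 1<a _ = subst (_< a * suc b) (*-identityˡ (suc b)) (*-monoˡ-< (suc b) 1<a)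

complexity-recursion : ∀ {T n v} → 2 ≤ n → Table T n → Candidate T n v →
  (∀ a → 1 ≤ a → a ≤ n / 2 → v ≤ T a + T (n ∸ a)) →
  (∀ a → 1 < a → a < n → a ∣ n → v ≤ T a + T (quotient n a)) →
  ‖ n ‖≡ v
complexity-recursion {T} {n} {v} 2≤n table
  (candidate {a} {b} 1≤a a<n 1≤b b<n combines v≡) sums products =
  attained (proj₁ (table a 1≤a a<n)) (proj₁ (table b 1≤b b<n)) combines , minimal
  where
  attained : (∃[ e ] value e ≡ a × ones e ≡ T a) →
             (∃[ e ] value e ≡ b × ones e ≡ T b) →
             a + b ≡ n ⊎ a * b ≡ n → ∃[ e ] value e ≡ n × ones e ≡ v
  attained (e , ve , oe) (f , vf , of) (inj₁ p) =
    e ⊕ f , trans (cong₂ _+_ ve vf) p , trans (cong₂ _+_ oe of) (sym v≡)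
  attained (e , ve , oe) (f , vf , of) (inj₂ p) =
    e ⊗ f , trans (cong₂ _*_ ve vf) p , trans (cong₂ _+_ oe of) (sym v≡)

  smaller-half : ∀ {x y} → x ≤ y → x + y ≡ n → x ≤ n / 2
  smaller-half {x} {y} x≤y refl = subst (_≤ (x + y) / 2) (m*n/n≡m x 2)
    (/-monoˡ-≤ 2 (≤-trans (≤-reflexive (*-comm x 2))
      (+-monoʳ-≤ x (≤-trans (≤-reflexive (+-identityʳ x)) x≤y))))

  sum-≤ : ∀ {x y} → 1 ≤ x → x ≤ y → x + y ≡ n → v ≤ T x + T y
  sum-≤ {x} {y} 1≤x x≤y p = subst (λ z → v ≤ T x + T z)
    (trans (cong (_∸ x) (sym p)) (m+n∸m≡n x y)) (sums x 1≤x (smaller-half x≤y p))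

  T-≤ : ∀ e → value e < n → T (value e) ≤ ones e
  T-≤ e e<n = proj₂ (table (value e) (value≥1 e) e<n) e refl

  minimal : ∀ e → value e ≡ n → v ≤ ones e
  minimal 𝟙 p = contradiction (≤-trans 2≤n (≤-reflexive (sym p))) λ { (s≤s ()) }
  minimal (e ⊕ f) p = ≤-trans v≤ (+-mono-≤
      (T-≤ e (subst (value e <_) p (m<m+n _ (value≥1 f))))
      (T-≤ f (subst (value f <_) p (m<n+m _ (value≥1 e)))))
    where
    v≤ : v ≤ T (value e) + T (value f)
    -- With the smaller summand in front, the split lies in the searched range up to n / 2.
    v≤ with ≤-total (value e) (value f)
    ... | inj₁ e≤f = sum-≤ (value≥1 e) e≤f p
    ... | inj₂ f≤e = subst (v ≤_) (+-comm (T (value f)) _)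
      (sum-≤ (value≥1 f) f≤e (trans (+-comm (value f) _) p))
  minimal (e ⊗ f) p with value e ≟ 1 | value f ≟ 1
  -- A factor 1 leaves the value unchanged, so the table says nothing about the other factor. The
  -- induction is therefore on expressions and passes to that factor, which has no more ones than
  -- the product.
  ... | yes e≡1 | _ = ≤-trans (minimal f (trans (sym (*-identityˡ _))
          (trans (cong (_* value f) (sym e≡1)) p))) (m≤n+m _ _)
  ... | no _ | yes f≡1 = ≤-trans (minimal e (trans (sym (*-identityʳ _))
          (trans (cong (value e *_) (sym f≡1)) p))) (m≤m+n _ _)
  ... | no e≢1 | no f≢1 = ≤-trans v≤ (+-mono-≤ (T-≤ e e<n) (T-≤ f f<n))
    where
    1<e : 1 < value e
    1<e = ≤∧≢⇒< (value≥1 e) (λ q → e≢1 (sym q))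
    1<f : 1 < value f
    1<f = ≤∧≢⇒< (value≥1 f) (λ q → f≢1 (sym q))
    e<n : value e < n
    e<n = subst (value e <_) (trans (*-comm (value f) _) p)
      (m<n*m (value f) (value e) 1<f (value≥1 e))
    f<n : value f < n
    f<n = subst (value f <_) p (m<n*m (value e) (value f) 1<e (value≥1 f))
    v≤ : v ≤ T (value e) + T (value f)
    v≤ = subst (λ z → v ≤ T (value e) + T z)
      (trans (cong (λ z → quotient z (value e)) (sym p))
             (quotient-cofactor (value e) (value f) (value≥1 e)))
      (products (value e) 1<e e<n (divides (value f) (trans (sym p) (*-comm (value e) _))))

-- Bit sizes of small states and expressions.

-- A literal `c` weighs `suc c`, so that one measure bounds both the value of an expression, in
-- multiples of W, and the number of its scratch words.
size : Expr → ℕ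
size (lit c)   = suc c
size (! x)     = 1
size (a [ e ]) = suc (size e)
size (e +ᵉ f)  = suc (size e + size f)
size (e -ᵉ f)  = suc (size e + size f)
size (e /ᵉ f)  = suc (size e + size f)

sum-bounded : ∀ {f : ℕ → ℕ} {c} → (∀ i → f i ≤ c) → ∀ is →
  ℕList.sum (List.map f is) ≤ length is * c
sum-bounded f≤c []       = z≤n
sum-bounded f≤c (i ∷ is) = +-mono-≤ (f≤c i) (sum-bounded f≤c is)

vec-sum-bounded : ∀ {A : Set} {f : A → ℕ} {c n} {xs : Vec A n} →
  All (λ x → f x ≤ c) xs → Vec.sum (Vec.map f xs) ≤ n * c
vec-sum-bounded []         = z≤n
vec-sum-bounded (px ∷ pxs) = +-mono-≤ px (vec-sum-bounded pxs)

All-≔ : ∀ {A : Set} {P : A → Set} {n v} {xs : Vec A n} → All P xs → P v →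
  ∀ i → All P (xs [ i ]≔ v)
All-≔ (_  ∷ pxs) pv zero    = pv ∷ pxs
All-≔ (px ∷ pxs) pv (suc i) = px ∷ All-≔ pxs pv i

bits-mono : ∀ {m n} → m ≤ n → bits m ≤ bits n
bits-mono m≤n = s≤s (⌊log₂⌋-mono-≤ m≤n)

-- No expression of the program has size above 7.
wordBits stateBits spaceBound : ℕ → ℕ
wordBits W   = bits (7 * W)
stateBits W  = 10 * wordBits W + 4 * (W * wordBits W)
spaceBound W = stateBits W + 14 * wordBits W

module Logic (W : ℕ) (1≤W : 1 ≤ W) where

  SmallArray : Array → Set
  SmallArray a = extent a ≤ W × (∀ i → cell a i ≤ W)

  Small : State → Set
  Small s = All (_≤ W) (vars s) × All SmallArray (arrays s)

  W≤7W : W ≤ 7 * W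
  W≤7W = m≤m+n W _

  arraySize-≤ : ∀ {a} → SmallArray a → arraySize a ≤ W * wordBits W
  arraySize-≤ {a} (extent≤ , cell≤) = ≤-trans
    (sum-bounded (λ i → bits-mono (≤-trans (cell≤ i) W≤7W)) (upTo (extent a)))
    (*-monoˡ-≤ (wordBits W) (≤-trans (≤-reflexive (length-upTo (extent a))) extent≤))

  stateSize-≤ : ∀ {s} → Small s → stateSize s ≤ stateBits W
  stateSize-≤ (vs , as) = +-mono-≤
    (vec-sum-bounded (All.map (λ v≤ → bits-mono (≤-trans v≤ W≤7W)) vs))
    (vec-sum-bounded (All.map arraySize-≤ as))

  small-assignVar : ∀ {s} x v → Small s → v ≤ W → Small (assignVar x v s)
  small-assignVar x v (vs , as) v≤ = All-≔ vs v≤ x , as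

  small-assignCell : ∀ {s} a i v → Small s → i < W → v ≤ W →
    Small (assignCell a i v s)
  small-assignCell {s} a i v (vs , as) i< v≤ = vs , All-≔ as (extent≤ , cell≤) a
    where
    old : SmallArray (lookup (arrays s) a)
    old = lookup⁺ as a
    extent≤ : extent (lookup (arrays s) a) ⊔ suc i ≤ W
    extent≤ = ⊔-lub (proj₁ old) i<
    cell≤ : ∀ j → (if i ≡ᵇ j then v else cell (lookup (arrays s) a) j) ≤ W
    cell≤ j with i ≡ᵇ j
    ... | true  = v≤
    ... | false = proj₂ old j

  binary-≤ : ∀ {x a b u v w} → x ≤ w → u ≤ a * w → v ≤ b * w →
    x + (u + v) ≤ suc (a + b) * w
  binary-≤ {a = a} {b} {w = w} x≤ u≤ v≤ =
    +-mono-≤ x≤ (≤-trans (+-mono-≤ u≤ v≤) (≤-reflexive (sym (*-distribʳ-+ w a b))))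

  value-≤ : ∀ e {s} → Small s → ⟦ e ⟧ s ≤ size e * W
  value-≤ (lit c) sm = ≤-trans (n≤1+n c)
    (≤-trans (≤-reflexive (sym (*-identityʳ (suc c)))) (*-monoʳ-≤ (suc c) 1≤W))
  value-≤ (! x) (vs , _) = ≤-trans (lookup⁺ vs x) (m≤m+n W 0)
  value-≤ (a [ e ]) (_ , as) = ≤-trans (proj₂ (lookup⁺ as a) _) (m≤m+n W _)
  value-≤ (e +ᵉ f) {s} sm =
    binary-≤ {0} {size e} {size f} z≤n (value-≤ e sm) (value-≤ f sm)
  value-≤ (e -ᵉ f) {s} sm = ≤-trans (m∸n≤m _ (⟦ f ⟧ s)) (≤-trans (m≤m+n _ (⟦ f ⟧ s))
    (binary-≤ {0} {size e} {size f} z≤n (value-≤ e sm) (value-≤ f sm)))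
  value-≤ (e /ᵉ f) {s} sm = ≤-trans (quotient-≤ _ (⟦ f ⟧ s)) (≤-trans (m≤m+n _ (⟦ f ⟧ s))
    (binary-≤ {0} {size e} {size f} z≤n (value-≤ e sm) (value-≤ f sm)))

  bits-≤ : ∀ e {s} → Small s → size e ≤ 7 → bits (⟦ e ⟧ s) ≤ wordBits W
  bits-≤ e sm e≤7 = bits-mono (≤-trans (value-≤ e sm) (*-monoˡ-≤ W e≤7))

  left-≤ : ∀ {a b} → suc (a + b) ≤ 7 → a ≤ 7
  left-≤ {a} {b} p = ≤-trans (m≤m+n a b) (≤-trans (n≤1+n _) p)

  right-≤ : ∀ {a b} → suc (a + b) ≤ 7 → b ≤ 7
  right-≤ {a} {b} p = ≤-trans (m≤n+m b a) (≤-trans (n≤1+n _) p)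

  -- Subexpressions inherit the size limit 7, so each of the at most `size e` values held
  -- simultaneously fits into one word.
  scratch-≤ : ∀ e {s} → Small s → size e ≤ 7 → scratch e s ≤ size e * wordBits W
  scratch-≤ e@(lit c) sm p = ≤-trans (bits-≤ e sm p) (m≤m+n _ _)
  scratch-≤ e@(! x) sm p = ≤-trans (bits-≤ e sm p) (m≤m+n _ _)
  scratch-≤ e@(a [ f ]) sm p =
    +-mono-≤ (bits-≤ e sm p) (scratch-≤ f sm (≤-trans (n≤1+n _) p))
  scratch-≤ e@(f +ᵉ g) sm p = binary-≤ {a = size f} {size g} (bits-≤ e sm p)
    (scratch-≤ f sm (left-≤ p)) (scratch-≤ g sm (right-≤ {size f} p))
  scratch-≤ e@(f -ᵉ g) sm p = binary-≤ {a = size f} {size g} (bits-≤ e sm p)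
    (scratch-≤ f sm (left-≤ p)) (scratch-≤ g sm (right-≤ {size f} p))
  scratch-≤ e@(f /ᵉ g) sm p = binary-≤ {a = size f} {size g} (bits-≤ e sm p)
    (scratch-≤ f sm (left-≤ p)) (scratch-≤ g sm (right-≤ {size f} p))

  scratch-≤7 : ∀ e {s} → Small s → size e ≤ 7 → scratch e s ≤ 7 * wordBits W
  scratch-≤7 e sm p = ≤-trans (scratch-≤ e sm p) (*-monoˡ-≤ (wordBits W) p)

  one-expression : ∀ e {s} → Small s → size e ≤ 7 →
    stateSize s + scratch e s ≤ spaceBound W
  one-expression e {s} sm p = +-mono-≤ (stateSize-≤ {s} sm)
    (≤-trans (scratch-≤7 e sm p) (*-monoˡ-≤ (wordBits W) {7} {14} (≤ᵇ⇒≤ 7 14 tt)))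

  -- A test or an array write holds the scratch values of two expressions at once, whence the 14 = 7
  -- + 7 words in `spaceBound`.
  two-expressions : ∀ e f {s} → Small s → size e ≤ 7 → size f ≤ 7 →
    stateSize s + (scratch e s + scratch f s) ≤ spaceBound W
  two-expressions e f {s} sm p q = +-mono-≤ (stateSize-≤ {s} sm)
    (≤-trans (+-mono-≤ (scratch-≤7 e sm p) (scratch-≤7 f sm q))
             (≤-reflexive (sym (*-distribʳ-+ (wordBits W) 7 7))))

  small-space : ∀ {s} → Small s → stateSize s ≤ spaceBound W
  small-space {s} sm = ≤-trans (stateSize-≤ {s} sm) (m≤m+n _ _)

  -- A program logic for correctness, time and space.

  record Outcome (c : Cmd) (s : State) (t : ℕ) (Q : State → Set) : Set where
    constructor outcome
    field
      {final}     : State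
      {time space} : ℕ
      derivation  : ⟨ c , s ⟩⇓⟨ final , time , space ⟩
      time-≤      : time ≤ t
      space-≤     : space ≤ spaceBound W
      small       : Small final
      post        : Q final

  -- Smallness of the start state is a premise inside the record, so postconditions and loop
  -- invariants need not mention it.
  record Run (c : Cmd) (s : State) (t : ℕ) (Q : State → Set) : Set where
    constructor runs
    field
      from-small : Small s → Outcome c s t Q

  open Run public

  within : ∀ {c s t t′ Q} → Run c s t Q → t ≤ t′ → Run c s t′ Q
  within {c} {s} {t} {t′} {Q} (runs r) t≤ = runs λ sm → go (r sm)
    where
    go : Outcome c s t Q → Outcome c s t′ Q
    go (outcome r time≤ space≤ sm q) = outcome r (≤-trans time≤ t≤) space≤ sm q

  skip : ∀ {s Q} → Q s → Run Skip s 0 Q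
  skip {s} q = runs λ sm → outcome ⇓skip z≤n (small-space {s} sm) sm q

  -- The implicit size condition computes to the unit type for a concrete expression. The bound on
  -- the new value may use smallness of the state, which settles plain array reads.
  assign : ∀ {x e s} {Q : State → Set} {_ : T (size e ≤ᵇ 7)} →
    (Small s → ⟦ e ⟧ s ≤ W) → Q (assignVar x (⟦ e ⟧ s) s) →
    Run (x ≔ e) s (suc (cost e)) Q
  assign {x} {e} {s} {_} {e≤7} v≤ q = runs λ sm →
    let sm′ = small-assignVar {s} x (⟦ e ⟧ s) sm (v≤ sm) in
    outcome ⇓assign ≤-refl
      (⊔-lub (one-expression e sm (≤ᵇ⇒≤ _ 7 e≤7)) (small-space sm′)) sm′ q

  write : ∀ {a i e s} {Q : State → Set} {_ : T (size i ≤ᵇ 7)} {_ : T (size e ≤ᵇ 7)} →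
    (Small s → ⟦ i ⟧ s < W) → (Small s → ⟦ e ⟧ s ≤ W) →
    Q (assignCell a (⟦ i ⟧ s) (⟦ e ⟧ s) s) →
    Run (a [ i ]≔ᵃ e) s (suc (cost i + cost e)) Q
  write {a} {i} {e} {s} {_} {i≤7} {e≤7} i< v≤ q = runs λ sm →
    let sm′ = small-assignCell {s} a (⟦ i ⟧ s) (⟦ e ⟧ s) sm (i< sm) (v≤ sm) in
    outcome ⇓write ≤-refl
      (⊔-lub (two-expressions i e sm (≤ᵇ⇒≤ _ 7 i≤7) (≤ᵇ⇒≤ _ 7 e≤7)) (small-space sm′))
      sm′ q

  infixr 3 _then_

  _then_ : ∀ {c₁ c₂ s t₁ t₂ R Q} → Run c₁ s t₁ R →
    (∀ s₁ → R s₁ → Run c₂ s₁ t₂ Q) → Run (c₁ ⨾ c₂) s (t₁ + t₂) Q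
  _then_ {c₁} {c₂} {s} {t₁} {t₂} {R} {Q} (runs r₁) k = runs λ sm → go (r₁ sm)
    where
    go : Outcome c₁ s t₁ R → Outcome (c₁ ⨾ c₂) s (t₁ + t₂) Q
    go (outcome r₁ time≤₁ space≤₁ sm₁ p) with from-small (k _ p) sm₁
    ... | outcome r₂ time≤₂ space≤₂ sm₂ q = outcome (⇓seq r₁ r₂)
      (+-mono-≤ time≤₁ time≤₂) (⊔-lub space≤₁ space≤₂) sm₂ q

  -- As in a weakest precondition calculus, the postcondition of `c₁` is the run of `c₂`; the
  -- intermediate state stays a concrete term and needs no assertion of its own.
  seq : ∀ {c₁ c₂ s t₁ t₂ Q} → Run c₁ s t₁ (λ s₁ → Run c₂ s₁ t₂ Q) →
    Run (c₁ ⨾ c₂) s (t₁ + t₂) Q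
  seq r = r then λ _ r₂ → r₂

  cond : ∀ {e f c₁ c₂ s t₁ t₂ Q} {_ : T (size e ≤ᵇ 7)} {_ : T (size f ≤ᵇ 7)} →
    (True (e ⩽ f) s → Run c₁ s t₁ Q) → (False (e ⩽ f) s → Run c₂ s t₂ Q) →
    Run (If e ⩽ f Then c₁ Else c₂) s (testCost (e ⩽ f) + (t₁ ⊔ t₂)) Q
  cond {e} {f} {c₁} {c₂} {s} {t₁} {t₂} {Q} {e≤7} {f≤7} yes-run no-run =
    runs λ sm → go sm (⟦ e ⟧ s ≤? ⟦ f ⟧ s)
    where
    go : Small s → _ → Outcome (If e ⩽ f Then c₁ Else c₂) s (testCost (e ⩽ f) + (t₁ ⊔ t₂)) Q
    go sm (yes p) with from-small (yes-run p) sm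
    ... | outcome r time≤ space≤ sm′ q = outcome (⇓then p r)
      (+-monoʳ-≤ (testCost (e ⩽ f)) (≤-trans time≤ (m≤m⊔n t₁ t₂)))
      (⊔-lub (two-expressions e f sm (≤ᵇ⇒≤ _ 7 e≤7) (≤ᵇ⇒≤ _ 7 f≤7)) space≤) sm′ q
    go sm (no ¬p) with from-small (no-run ¬p) sm
    ... | outcome r time≤ space≤ sm′ q = outcome (⇓else ¬p r)
      (+-monoʳ-≤ (testCost (e ⩽ f)) (≤-trans time≤ (m≤n⊔m t₁ t₂)))
      (⊔-lub (two-expressions e f sm (≤ᵇ⇒≤ _ 7 e≤7) (≤ᵇ⇒≤ _ 7 f≤7)) space≤) sm′ q

  -- The index of the invariant is fuel: whenever the test holds it must be a successor, and the
  -- body lowers it by one. Recursion on it proves termination and counts the iterations.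
  while : ∀ {e f c t} {Q : State → Set} {_ : T (size e ≤ᵇ 7)} {_ : T (size f ≤ᵇ 7)}
    (I : ℕ → State → Set) →
    (∀ {j s} → I j s → False (e ⩽ f) s → Q s) →
    (∀ {j s} → I j s → True (e ⩽ f) s → ∃[ j′ ] j ≡ suc j′ × Run c s t (I j′)) →
    ∀ j {s} → I j s →
    Run (While e ⩽ f Do c) s (j * (testCost (e ⩽ f) + t) + testCost (e ⩽ f)) Q
  while {e} {f} {c} {t} {Q} {e≤7} {f≤7} I exit body = loop
    where
    tc : ℕ
    tc = testCost (e ⩽ f)

    loop : ∀ j {s} → I j s → Run (While e ⩽ f Do c) s (j * (tc + t) + tc) Q
    loop j {s} inv = runs λ sm → go sm (⟦ e ⟧ s ≤? ⟦ f ⟧ s)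
      where
      test-space : Small s → testSpace (e ⩽ f) s ≤ spaceBound W
      test-space sm = two-expressions e f sm (≤ᵇ⇒≤ _ 7 e≤7) (≤ᵇ⇒≤ _ 7 f≤7)

      go : Small s → _ → Outcome (While e ⩽ f Do c) s (j * (tc + t) + tc) Q
      go sm (no ¬p) = outcome (⇓exit ¬p) (m≤n+m tc _) (test-space sm) sm (exit inv ¬p)
      go sm (yes p) with body inv p
      ... | j′ , refl , r with from-small r sm
      ... | outcome r₁ time≤₁ space≤₁ sm₁ inv′ with from-small (loop j′ inv′) sm₁
      ... | outcome r₂ time≤₂ space≤₂ sm₂ q = outcome (⇓loop p r₁ r₂)
        (≤-trans (+-monoʳ-≤ tc (+-mono-≤ time≤₁ time≤₂))
                 (≤-reflexive regroup))
        (⊔-lub (test-space sm) (⊔-lub space≤₁ space≤₂)) sm₂ q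
        where
        regroup : tc + (t + (j′ * (tc + t) + tc)) ≡ suc j′ * (tc + t) + tc
        regroup = trans (sym (+-assoc tc t _)) (sym (+-assoc (tc + t) (j′ * (tc + t)) tc))

-- Linked divisor lists and the append operation.

module DivisorLists (N : ℕ) where

  InRange IsNode : ℕ → ℕ → Set
  InRange n x = 1 ≤ x × x ≤ n
  IsNode f i  = 1 ≤ i × i < f

  NoneBetween : (ℕ → ℕ) → ℕ → ℕ → ℕ → Set
  NoneBetween own i q x = ∀ j → i < j → j < q → own j ≢ x

  -- `own i` is the number whose list contains node i; it is not stored by the
  -- program.  The nodes of one list are created in the order in which they are
  -- linked, so the successor of a node is the next larger node with the same
  -- owner; this makes the lists a local property of the nodes, with no aliasing
  -- to consider.
  data Link (f : ℕ) (own V : ℕ → ℕ) (i : ℕ) : ℕ → Set where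
    end  : NoneBetween own i f (own i) → Link f own V i 0
    step : ∀ {q} → i < q → q < f → own q ≡ own i → V i < V q →
           NoneBetween own i q (own i) → Link f own V i q

  record Node (f : ℕ) (own V X : ℕ → ℕ) (i : ℕ) : Set where
    constructor node
    field
      owner    : InRange N (own i)
      divisor  : V i ∣ own i
      link     : Link f own V i (X i)

  record Nodes (f : ℕ) (own V X : ℕ → ℕ) : Set where
    field
      N<f     : N < f
      heads   : ∀ {x} → InRange N x → own x ≡ x
      nodes   : ∀ {i} → IsNode f i → Node f own V X i

  -- During pass `k`, with `m` the next multiple to be served, numbers from `m` on have not yet
  -- received `k`. The field `below` records this and makes the appended value strictly larger than
  -- its predecessor.
  record Last (f k m : ℕ) (own V : ℕ → ℕ) (x ℓ : ℕ) : Set where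
    constructor last
    field
      is-node   : IsNode f ℓ
      owned     : own ℓ ≡ x
      none-after : NoneBetween own ℓ f x
      at-most   : V ℓ ≤ k
      below     : m ≤ x → V ℓ < k

  Entry : ℕ → (ℕ → ℕ) → (ℕ → ℕ) → ℕ → ℕ → Set
  Entry f own V x d = ∃[ i ] IsNode f i × own i ≡ x × V i ≡ d

  -- Since `own` is a field, each append can supply an extended ownership function.
  record Building (f k m : ℕ) (V X L : ℕ → ℕ) : Set where
    field
      own     : ℕ → ℕ
      nodesOf : Nodes f own V X
      lasts   : ∀ {x} → InRange N x → Last f k m own V x (L x)
      entries : ∀ {x d} → InRange N x → d ∣ x → d < k ⊎ d ≡ k × x < m →
                Entry f own V x d

  record Built (f : ℕ) (V X : ℕ → ℕ) : Set where
    field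
      own     : ℕ → ℕ
      nodesOf : Nodes f own V X
      entries : ∀ {x d} → InRange N x → d ∣ x → Entry f own V x d
    open Nodes nodesOf public

  ∣⇒≤′ : ∀ {d x} → 1 ≤ x → d ∣ x → d ≤ x
  ∣⇒≤′ {x = suc x} _ d∣x = ∣⇒≤ d∣x

  building-start : ∀ {V X L} → (∀ {x} → InRange N x → V x ≡ 1 × X x ≡ 0 × L x ≡ x) →
    Building (suc N) 2 2 V X L
  building-start {V} {X} {L} init = record
    { own     = λ x → x
    ; nodesOf = record
      { N<f   = ≤-refl
      ; heads = λ _ → refl
      ; nodes = λ {i} → start-node
      }
    ; lasts   = start-last
    ; entries = start-entry
    }
    where
    start-node : ∀ {i} → IsNode (suc N) i → Node (suc N) (λ x → x) V X i
    start-node {i} (1≤i , s≤s i≤N) with init (1≤i , i≤N)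
    ... | v , x , _ = node (1≤i , i≤N) (subst (_∣ i) (sym v) (1∣ i))
      (subst (Link _ _ _ i) (sym x) (end λ j i<j _ j≡i → <-irrefl (sym j≡i) i<j))

    start-last : ∀ {x} → InRange N x → Last (suc N) 2 2 (λ x → x) V x (L x)
    start-last {x} r@(1≤x , x≤N) with init r
    ... | v , _ , l = last
      (subst (IsNode (suc N)) (sym l) (1≤x , s≤s x≤N))
      l
      (λ j l<j _ j≡x → <-irrefl (trans l (sym j≡x)) l<j)
      (≤-trans (≤-reflexive (trans (cong V l) v)) (n≤1+n 1))
      (λ _ → s≤s (≤-reflexive (trans (cong V l) v)))

    start-entry : ∀ {x d} → InRange N x → d ∣ x → d < 2 ⊎ d ≡ 2 × x < 2 →
      Entry (suc N) (λ x → x) V x d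
    start-entry {x} {zero}  (1≤x , _) d∣x _ = contradiction (0∣⇒≡0 d∣x) (>⇒≢ 1≤x)
    start-entry {x} {suc zero} r@(1≤x , x≤N) d∣x _ =
      x , (1≤x , s≤s x≤N) , refl , proj₁ (init r)
    start-entry {x} {suc (suc d)} _ _ (inj₁ (s≤s (s≤s ())))
    start-entry {x} {suc (suc d)} (1≤x , _) d∣x (inj₂ (refl , x<2)) =
      contradiction (∣⇒≤′ 1≤x d∣x) (<⇒≱ x<2)

  -- With `m` beyond N every multiple of `k` has been served. Restarting with `m` equal to the new
  -- `k` promises nothing more, since a positive number below `suc k` is not divisible by `suc k`.
  building-next : ∀ {f k m V X L} → N < m → Building f k m V X L →
    Building f (suc k) (suc k) V X L
  building-next {f} {k} {m} {V} {X} {L} N<m h = record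
    { own     = own
    ; nodesOf = nodesOf
    ; lasts   = λ r → let last i o n a _ = lasts r in
                      last i o n (m≤n⇒m≤1+n a) (λ _ → s≤s a)
    ; entries = next-entry
    }
    where
    open Building h
    next-entry : ∀ {x d} → InRange N x → d ∣ x → d < suc k ⊎ d ≡ suc k × x < suc k →
      Entry f own V x d
    next-entry {x} {d} r@(1≤x , x≤N) d∣x (inj₁ (s≤s d≤k)) with d ≟ k
    ... | yes d≡k = entries r d∣x (inj₂ (d≡k , ≤-trans (s≤s x≤N) N<m))
    ... | no  d≢k = entries r d∣x (inj₁ (≤∧≢⇒< d≤k d≢k))
    next-entry (1≤x , _) d∣x (inj₂ (refl , x<)) = contradiction (∣⇒≤′ 1≤x d∣x) (<⇒≱ x<)

  building-done : ∀ {f k V X L} → N < k → Building f k k V X L → Built f V X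
  building-done N<k h = record
    { own     = own
    ; nodesOf = nodesOf
    ; entries = λ { r@(1≤x , x≤N) d∣x → entries r d∣x
                    (inj₁ (≤-trans (s≤s (≤-trans (∣⇒≤′ 1≤x d∣x) x≤N)) N<k)) }
    }
    where open Building h

  -- Otherwise x - m would be a positive multiple of `k` below `k`. This justifies the jump from `m`
  -- to `m + k`.
  no-multiple-between : ∀ {k m x} → k ∣ m → k ∣ x → m < x → ¬ x < m + k
  no-multiple-between {k} {m} {x} k∣m k∣x m<x x<m+k = <⇒≱
    (+-cancelˡ-< m _ _ (subst (_< m + k) (sym (m+[n∸m]≡n (<⇒≤ m<x))) x<m+k))
    (∣⇒≤′ (m<n⇒0<n∸m m<x)
      (∣m+n∣m⇒∣n (subst (k ∣_) (sym (m+[n∸m]≡n (<⇒≤ m<x))) k∣x) k∣m))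

  -- The arrays after an append enter only through equations for their values, which keeps nested
  -- updates out of the argument.
  module _ {f k m : ℕ} {V X L V′ X′ L′ : ℕ → ℕ}
    (h : Building f k m V X L) (1≤k : 1 ≤ k) (m-range : InRange N m) (k∣m : k ∣ m)
    (V′-new : V′ f ≡ k) (V′-old : ∀ {i} → i ≢ f → V′ i ≡ V i)
    (X′-new : X′ f ≡ 0) (X′-last : X′ (L m) ≡ f)
    (X′-old : ∀ {i} → i ≢ f → i ≢ L m → X′ i ≡ X i)
    (L′-new : L′ m ≡ f) (L′-old : ∀ {x} → x ≢ m → L′ x ≡ L x)
    where
    private
      open Building h
      open Nodes nodesOf
      open Last (lasts m-range)

      own′ : ℕ → ℕ
      own′ = update f m own

      own′-new : own′ f ≡ m
      own′-new = update-same f m own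

      own′-old : ∀ {i} → i ≢ f → own′ i ≡ own i
      own′-old = update-other m own

      range≢f : ∀ {x} → InRange N x → x ≢ f
      range≢f (_ , x≤N) = <⇒≢ (≤-trans (s≤s x≤N) N<f)

      1≤f : 1 ≤ f
      1≤f = ≤-trans (s≤s z≤n) N<f

      widen : ∀ {i} → IsNode f i → IsNode (suc f) i
      widen (1≤i , i<f) = 1≤i , m≤n⇒m≤1+n i<f

      none-old : ∀ {i q x} → q ≤ f → NoneBetween own i q x → NoneBetween own′ i q x
      none-old q≤f none j i<j j<q e =
        none j i<j j<q (trans (sym (own′-old (<⇒≢ (<-≤-trans j<q q≤f)))) e)

      none-suc : ∀ {i x} → x ≢ m → NoneBetween own i f x → NoneBetween own′ i (suc f) x
      none-suc x≢m none j i<j (s≤s j≤f) e with j ≟ f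
      ... | yes refl = x≢m (trans (sym e) own′-new)
      ... | no j≢f = none-old ≤-refl none j i<j (≤∧≢⇒< j≤f j≢f) e

      -- Both `i` and `L m` are nodes of `m` with no later one, so neither precedes the other. Hence
      -- the only `end` link invalidated by the new node `f` is that of `L m`.
      unlinked-last : ∀ {i} → i < f → own i ≡ m → NoneBetween own i f m → i ≡ L m
      unlinked-last {i} i<f e none with <-cmp i (L m)
      ... | tri< i<l _ _ = contradiction owned (none (L m) i<l (proj₂ is-node))
      ... | tri≈ _ i≡l _ = i≡l
      ... | tri> _ _ l<i = contradiction e (none-after i l<i i<f)

      link-old : ∀ {i q} → i < f → i ≢ L m → Link f own V i q →
        Link (suc f) own′ V′ i q
      link-old {i} i<f i≢l (end none) = end
        (subst (NoneBetween own′ i (suc f)) (sym (own′-old (<⇒≢ i<f)))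
          (none-suc (λ e → i≢l (unlinked-last i<f e (subst (NoneBetween own i f) e none)))
                    none))
      link-old {i} i<f i≢l (step i<q q<f same V< none) = step i<q (m≤n⇒m≤1+n q<f)
        (trans (own′-old (<⇒≢ q<f)) (trans same (sym (own′-old (<⇒≢ i<f)))))
        (subst₂ _<_ (sym (V′-old (<⇒≢ i<f))) (sym (V′-old (<⇒≢ q<f))) V<)
        (none-old (<⇒≤ q<f) (subst (NoneBetween own i _) (sym (own′-old (<⇒≢ i<f))) none))

      link-last : Link (suc f) own′ V′ (L m) f
      link-last = step (proj₂ is-node) ≤-refl
        (trans own′-new (sym own′-last))
        -- The number `m` is yet to receive `k`, so `below` gives the strict increase.
        (subst₂ _<_ (sym (V′-old l≢f)) (sym V′-new) (below ≤-refl))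
        (none-old ≤-refl (subst (NoneBetween own (L m) f) (sym own′-last) none-after))
        where
        l≢f : L m ≢ f
        l≢f = <⇒≢ (proj₂ is-node)
        own′-last : own′ (L m) ≡ m
        own′-last = trans (own′-old l≢f) owned

      new-node : Node (suc f) own′ V′ X′ f
      new-node = node (subst (InRange N) (sym own′-new) m-range)
        (subst₂ _∣_ (sym V′-new) (sym own′-new) k∣m)
        (subst (Link _ _ _ f) (sym X′-new)
          (end λ j f<j j<1+f → contradiction j<1+f (≤⇒≯ f<j)))

      append-node : ∀ {i} → IsNode (suc f) i → Node (suc f) own′ V′ X′ i
      append-node {i} (1≤i , s≤s i≤f) with i ≟ f
      ... | yes refl = new-node
      ... | no i≢f = node (subst (InRange N) (sym (own′-old i≢f)) owner)
        (subst₂ _∣_ (sym (V′-old i≢f)) (sym (own′-old i≢f)) divisor) linked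
        where
        i<f : i < f
        i<f = ≤∧≢⇒< i≤f i≢f
        open Node (nodes (1≤i , i<f))
        linked : Link (suc f) own′ V′ i (X′ i)
        linked with i ≟ L m
        ... | yes refl = subst (Link _ _ _ _) (sym X′-last) link-last
        ... | no i≢l   = subst (Link _ _ _ i) (sym (X′-old i≢f i≢l)) (link-old i<f i≢l link)

      append-last : ∀ {x} → InRange N x → Last (suc f) k (m + k) own′ V′ x (L′ x)
      append-last {x} r with x ≟ m
      ... | yes refl = subst (Last _ _ _ _ _ m) (sym L′-new) (last (1≤f , ≤-refl)
        own′-new
        (λ j f<j j<1+f → contradiction j<1+f (≤⇒≯ f<j)) (≤-reflexive V′-new)
        -- The number just served lies below the next multiple `m + k`, so `below` holds vacuously.
        (λ m+k≤m → contradiction m+k≤m (<⇒≱ (m<m+n m 1≤k))))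
      ... | no x≢m with lasts r
      ... | last is o n a l = subst (Last _ _ _ _ _ x) (sym (L′-old x≢m))
        (last (widen is) (trans (own′-old l≢f) o)
        (none-suc x≢m n) (subst (_≤ k) (sym (V′-old l≢f)) a)
        (λ m+k≤x → subst (_< k) (sym (V′-old l≢f)) (l (≤-trans (m≤m+n m k) m+k≤x))))
        where
        l≢f : L x ≢ f
        l≢f = <⇒≢ (proj₂ is)

      keep : ∀ {x d} → Entry f own V x d → Entry (suc f) own′ V′ x d
      keep (i , is , o , v) = i , widen is , trans (own′-old i≢f) o , trans (V′-old i≢f) v
        where
        i≢f : i ≢ f
        i≢f = <⇒≢ (proj₂ is)

      append-entry : ∀ {x d} → InRange N x → d ∣ x → d < k ⊎ d ≡ k × x < m + k →
        Entry (suc f) own′ V′ x d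
      append-entry r d∣x (inj₁ d<k) = keep (entries r d∣x (inj₁ d<k))
      append-entry {x} r d∣x (inj₂ (refl , x<m+k)) with <-cmp x m
      ... | tri< x<m _ _ = keep (entries r d∣x (inj₂ (refl , x<m)))
      ... | tri≈ _ refl _ = f , (1≤f , ≤-refl) , own′-new , V′-new
      ... | tri> _ _ m<x = contradiction x<m+k (no-multiple-between k∣m d∣x m<x)

    building-append : Building (suc f) k (m + k) V′ X′ L′
    building-append = record
      { own     = own′
      ; nodesOf = record
        { N<f   = m≤n⇒m≤1+n N<f
        ; heads = λ r → trans (own′-old (range≢f r)) (heads r)
        ; nodes = append-node
        }
      ; lasts   = append-last
      ; entries = append-entry
      }

  -- Invariants of the list-building loops.

  -- Here and in the later loop invariants, `enough` ties the fuel to the loop: with fuel 0 it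
  -- contradicts the loop test.
  record Starting (j n : ℕ) (V X L : ℕ → ℕ) : Set where
    constructor starting
    field
      1≤n    : 1 ≤ n
      enough : N < n + j
      filled : ∀ {x} → 1 ≤ x → x < n → V x ≡ 1 × X x ≡ 0 × L x ≡ x

  starting-step : ∀ {j n V X L} → Starting (suc j) n V X L →
    Starting j (n + 1) (update n 1 V) (update n 0 X) (update n n L)
  starting-step {j} {n} {V} {X} {L} (starting 1≤n enough filled)
    rewrite +-comm n 1 = starting (s≤s z≤n) (subst (N <_) (+-suc n j) enough) filled′
    where
    filled′ : ∀ {x} → 1 ≤ x → x < suc n →
      update n 1 V x ≡ 1 × update n 0 X x ≡ 0 × update n n L x ≡ x
    filled′ {x} 1≤x (s≤s x≤n) with x ≟ n
    ... | yes refl = update-same x 1 V , update-same x 0 X , update-same x x L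
    ... | no x≢n with filled 1≤x (≤∧≢⇒< x≤n x≢n)
    ... | v , x₁ , l = trans (update-other 1 V x≢n) v , trans (update-other 0 X x≢n) x₁ ,
                       trans (update-other n L x≢n) l

  starting-done : ∀ {j n V X L} → N < n → Starting j n V X L → Building (suc N) 2 2 V X L
  starting-done N<n (starting _ _ filled) =
    building-start λ { (1≤x , x≤N) → filled 1≤x (≤-<-trans x≤N N<n) }

  record Outer (j k f : ℕ) (V X L : ℕ → ℕ) : Set where
    constructor outer
    field
      2≤k    : 2 ≤ k
      enough : N < k + j
      free-≤ : f ≤ suc (harmonicSum N k)
      lists  : Building f k k V X L

  -- The fuel `j` also serves as a budget: `free-≤` reserves room for the `j` nodes still to come in
  -- this pass. The fuel `o` of the enclosing loop is carried along unchanged.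
  record Inner (o j k m f : ℕ) (V X L : ℕ → ℕ) : Set where
    constructor inner
    field
      2≤k          : 2 ≤ k
      enough-outer : N < k + suc o
      k≤N          : k ≤ N
      1≤m          : 1 ≤ m
      k∣m          : k ∣ m
      enough       : N < m + j * k
      free-≤       : f + j ≤ suc (harmonicSum N (suc k))
      lists        : Building f k m V X L

  inner-start : ∀ {o k f V X L} → k ≤ N → Outer (suc o) k f V X L →
    Inner o (quotient N k) k k f V X L
  inner-start {k = k} k≤N (outer 2≤k enough free-≤ lists) =
    inner 2≤k enough k≤N (≤-trans (n≤1+n 1) 2≤k) ∣-refl
      (n<k+n/k*k N k (≤-trans (n≤1+n 1) 2≤k)) (+-monoˡ-≤ _ free-≤) lists

  inner-step : ∀ {o j k m f V X L} → m ≤ N → Inner o (suc j) k m f V X L →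
    Inner o j k (m + k) (f + 1) (update f k V) (update (L m) f (update f 0 X)) (update m f L)
  inner-step {o} {j} {k} {m} {f} {V} {X} {L} m≤N
    (inner 2≤k enough-outer k≤N 1≤m k∣m enough free-≤ lists)
    rewrite +-comm f 1 =
    inner 2≤k enough-outer k≤N (≤-trans 1≤m (m≤m+n m k)) (∣m∣n⇒∣m+n k∣m ∣-refl)
      (subst (N <_) (sym (+-assoc m k (j * k))) enough)
      (≤-trans (≤-reflexive (sym (+-suc f j))) free-≤)
      (building-append lists (≤-trans (n≤1+n 1) 2≤k) (1≤m , m≤N) k∣m
        (update-same f k V) (update-other k V)
        -- The write at `L m` comes after the end marker is stored at `f`; the marker survives
        -- because the two nodes differ.
        (trans (update-other f (update f 0 X) f≢l) (update-same f 0 X))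
        (update-same (L m) f (update f 0 X))
        (λ i≢f i≢l → trans (update-other f (update f 0 X) i≢l) (update-other 0 X i≢f))
        (update-same m f L) (update-other f L))
    where
    f≢l : f ≢ L m
    f≢l = >⇒≢ (proj₂ (Last.is-node (Building.lasts lists (1≤m , m≤N))))

  inner-done : ∀ {o j k m f V X L} → N < m → Inner o j k m f V X L →
    Outer o (k + 1) f V X L
  inner-done {o} {j} {k} {f = f} N<m
    (inner 2≤k enough-outer k≤N 1≤m k∣m enough free-≤ lists) rewrite +-comm k 1 =
    outer (m≤n⇒m≤1+n 2≤k) (subst (N <_) (+-suc k o) enough-outer)
      (≤-trans (m≤m+n f j) free-≤) (building-next N<m lists)

  -- Minima over sums and products.

  -- One invariant for both searches: `Q` describes the indices tried so far, and `g` gives the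
  -- partner, `n ∸_` for sums and `quotient n` for products.
  record Min (T : ℕ → ℕ) (n : ℕ) (Q : ℕ → Set) (g : ℕ → ℕ) (v : ℕ) : Set where
    constructor min
    field
      attained : v ≡ suc N ⊎ Candidate T n v
      lower    : ∀ {a} → Q a → v ≤ T a + T (g a)

  min-⊆ : ∀ {T n g v} {Q R : ℕ → Set} → (∀ {a} → R a → Q a) → Min T n Q g v → Min T n R g v
  min-⊆ R⊆Q (min attained lower) = min attained λ r → lower (R⊆Q r)

  min-taken : ∀ {T n g v b} {Q R : ℕ → Set} → (∀ {a} → R a → Q a ⊎ a ≡ b) →
    Candidate T n (T b + T (g b)) → T b + T (g b) ≤ v →
    Min T n Q g v → Min T n R g (T b + T (g b))
  min-taken {T} {n} {g} {v} {b} {Q} {R} R⊆ cand c≤v (min _ lower) = min (inj₂ cand) lower′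
    where
    lower′ : ∀ {a} → R a → T b + T (g b) ≤ T a + T (g a)
    lower′ r with R⊆ r
    ... | inj₁ q    = ≤-trans c≤v (lower q)
    ... | inj₂ refl = ≤-refl

  min-kept : ∀ {T n g v b} {Q R : ℕ → Set} → (∀ {a} → R a → Q a ⊎ a ≡ b) →
    ¬ T b + T (g b) ≤ v → Min T n Q g v → Min T n R g v
  min-kept {T} {n} {g} {v} {b} {Q} {R} R⊆ c≰v (min attained lower) = min attained lower′
    where
    lower′ : ∀ {a} → R a → v ≤ T a + T (g a)
    lower′ r with R⊆ r
    ... | inj₁ q    = lower q
    ... | inj₂ refl = ≰⇒≥ c≰v

  record Ready (o n f : ℕ) (A V X : ℕ → ℕ) : Set where
    constructor ready
    field
      2≤n    : 2 ≤ n
      n≤N    : n ≤ N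
      enough : N < n + suc o
      lists  : Built f V X
      table  : Table A n

    A≤ : ∀ {x} → 1 ≤ x → x < n → A x ≤ x
    A≤ 1≤x x<n = complexity-≤ 1≤x (table _ 1≤x x<n)

    1≤n : 1 ≤ n
    1≤n = ≤-trans (n≤1+n 1) 2≤n

    1≤n/2 : 1 ≤ n / 2
    1≤n/2 = /-monoˡ-≤ 2 2≤n

    n/2<n : n / 2 < n
    n/2<n = m/n<m n 2 {{>-nonZero 1≤n}} ≤-refl

  Sums Products : (n : ℕ) (A : ℕ → ℕ) (v : ℕ) → Set
  Sums n A     = Min A n (λ a → 1 ≤ a × a ≤ n / 2) (n ∸_)
  Products n A = Min A n (λ a → 1 < a × a < n × a ∣ n) (quotient n)

  module _ {o n f : ℕ} {A V X : ℕ → ℕ} (r : Ready o n f A V X) where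
    open Ready r

    split-candidate : ∀ {k} → 1 ≤ k → k ≤ n / 2 → Candidate A n (A k + A (n ∸ k))
    split-candidate {k} 1≤k k≤n/2 = candidate 1≤k k<n (m<n⇒0<n∸m k<n)
      (∸-monoʳ-< 1≤k (<⇒≤ k<n)) (inj₁ (m+[n∸m]≡n (<⇒≤ k<n))) refl
      where
      k<n : k < n
      k<n = ≤-<-trans k≤n/2 n/2<n

    factor-candidate : ∀ {a} → 1 < a → a < n → a ∣ n → Candidate A n (A a + A (quotient n a))
    factor-candidate {a} 1<a a<n a∣n = candidate 1≤a a<n 1≤b b<n (inj₂ ab≡n) refl
      where
      1≤a : 1 ≤ a
      1≤a = <⇒≤ 1<a
      ab≡n : a * quotient n a ≡ n
      ab≡n = *-quotient a n 1≤a a∣n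
      1≤b : 1 ≤ quotient n a
      1≤b = n≢0⇒n>0 λ b≡0 → >⇒≢ 1≤n
        (trans (sym ab≡n) (trans (cong (a *_) b≡0) (*-zeroʳ a)))
      b<n : quotient n a < n
      b<n = subst (quotient n a <_) ab≡n (m<n*m a _ 1<a 1≤b)

    -- Bounds the variable `c`. The sums are in fact at most n, but `m` needs room for 2 N anyway.
    candidate-≤ : ∀ {v} → Candidate A n v → v ≤ N + N
    candidate-≤ (candidate 1≤a a<n 1≤b b<n _ refl) = +-mono-≤
      (≤-trans (A≤ 1≤a a<n) (≤-trans (<⇒≤ a<n) n≤N))
      (≤-trans (A≤ 1≤b b<n) (≤-trans (<⇒≤ b<n) n≤N))

    -- The split 1 + (n - 1) costs at most n ones, so `S` has left its default value.
    sum-≤N : ∀ {S} → Sums n A S → S ≤ N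
    sum-≤N {S} sums = begin
      S                  ≤⟨ Min.lower sums (≤-refl , 1≤n/2) ⟩
      A 1 + A (n ∸ 1)    ≤⟨ +-mono-≤ (A≤ ≤-refl 2≤n) (A≤ (m<n⇒0<n∸m 2≤n) (∸-monoʳ-< ≤-refl 1≤n)) ⟩
      1 + (n ∸ 1)        ≡⟨ m+[n∸m]≡n 1≤n ⟩
      n                  ≤⟨ n≤N ⟩
      N                  ∎
      where open ≤-Reasoning

    attained-≤N : ∀ {v} → v ≤ N → v ≡ suc N ⊎ Candidate A n v → Candidate A n v
    attained-≤N v≤N (inj₁ refl) = contradiction v≤N (<⇒≱ ≤-refl)
    attained-≤N v≤N (inj₂ cand) = cand

    minimum-is-complexity : ∀ {S P v} → Sums n A S → Products n A P →
      v ≤ S → v ≤ P → v ≡ S ⊎ v ≡ P → ‖ n ‖≡ v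
    minimum-is-complexity {S} {P} {v} sums products v≤S v≤P v≡ = complexity-recursion 2≤n table
      -- For prime n, `P` keeps the default `suc N`; the minimum does not, being at most S ≤ N.
      (attained-≤N (≤-trans v≤S (sum-≤N sums)) (attained v≡))
      (λ a 1≤a a≤n/2 → ≤-trans v≤S (Min.lower sums (1≤a , a≤n/2)))
      (λ a 1<a a<n a∣n → ≤-trans v≤P (Min.lower products (1<a , a<n , a∣n)))
      where
      attained : v ≡ S ⊎ v ≡ P → v ≡ suc N ⊎ Candidate A n v
      attained (inj₁ refl) = Min.attained sums
      attained (inj₂ refl) = Min.attained products

  table-extend : ∀ {T n v} → Table T n → ‖ n ‖≡ v → Table (update n v T) (suc n)
  table-extend {T} {n} {v} table ‖n‖ x 1≤x (s≤s x≤n) with x ≟ n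
  ... | yes refl = subst (‖ x ‖≡_) (sym (update-same x v T)) ‖n‖
  ... | no x≢n   = subst (‖ x ‖≡_) (sym (update-other v T x≢n))
                     (table x 1≤x (≤∧≢⇒< x≤n x≢n))

  table-start : ∀ T → Table (update 1 1 T) 2
  table-start T x 1≤x (s≤s x≤1) with ≤-antisym x≤1 1≤x
  ... | refl = complexity-one

  record Summing (j k n : ℕ) (A : ℕ → ℕ) (S : ℕ) : Set where
    constructor summing
    field
      1≤k     : 1 ≤ k
      enough  : n / 2 < k + j
      minimum : Min A n (λ a → 1 ≤ a × a < k) (n ∸_) S

  summing-start : ∀ {n A} → n ≤ N → Summing N 1 n A (N + 1)
  summing-start {n} n≤N = summing ≤-refl (s≤s (≤-trans (m/n≤m n 2) n≤N))
    (min (inj₁ (+-comm N 1)) λ { (1≤a , a<1) → contradiction a<1 (≤⇒≯ 1≤a) })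

  -- The argument `extend` stands for `min-taken` or `min-kept`, so both branches of the comparison
  -- share this bookkeeping.
  summing-step : ∀ {j k n A S S′} →
    (∀ {R : ℕ → Set} → (∀ {a} → R a → (1 ≤ a × a < k) ⊎ a ≡ k) →
       Min A n (λ a → 1 ≤ a × a < k) (n ∸_) S → Min A n R (n ∸_) S′) →
    Summing (suc j) k n A S → Summing j (k + 1) n A S′
  summing-step {j} {k} {n} extend (summing 1≤k enough minimum) rewrite +-comm k 1 =
    summing (s≤s z≤n) (subst (n / 2 <_) (+-suc k j) enough) (extend split minimum)
    where
    split : ∀ {a} → 1 ≤ a × a < suc k → (1 ≤ a × a < k) ⊎ a ≡ k
    split {a} (1≤a , s≤s a≤k) with a ≟ k
    ... | yes a≡k = inj₂ a≡k
    ... | no  a≢k = inj₁ (1≤a , ≤∧≢⇒< a≤k a≢k)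

  summing-done : ∀ {j k n A S} → n / 2 < k → Summing j k n A S → Sums n A S
  summing-done n/2<k (summing _ _ minimum) =
    min-⊆ (λ { (1≤a , a≤n/2) → 1≤a , ≤-<-trans a≤n/2 n/2<k }) minimum

  -- Traversal of one divisor list.

  module _ {f : ℕ} {V X : ℕ → ℕ} (lists : Built f V X) where
    open Built lists

    -- The fuel is measured by the value at the current node: each link raises `V p` by at least 1,
    -- and no value exceeds N.
    Position : (j n p : ℕ) → Set
    Position j n p = p ≡ 0 ⊎ (IsNode f p × own p ≡ n × N < V p + j)

    -- Successors have larger node numbers, so the nodes before position `p` are the owned ones
    -- numbered below `p`; at the end marker 0 they are all of them.
    Visited : (n p a : ℕ) → Set
    Visited n p a = 1 < a × a < n × ∃[ i ] IsNode f i × own i ≡ n × V i ≡ a × (p ≡ 0 ⊎ i < p)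

    record Traversal (j n p : ℕ) (A : ℕ → ℕ) (P : ℕ) : Set where
      constructor traversal
      field
        position : Position j n p
        minimum  : Min A n (Visited n p) (quotient n) P

    divisor-≤N : ∀ {i} → IsNode f i → V i ≤ N
    divisor-≤N is = let node (1≤o , o≤N) v∣o _ = nodes is in
      ≤-trans (∣⇒≤′ 1≤o v∣o) o≤N

    value-≥1 : ∀ {i} → IsNode f i → 1 ≤ V i
    value-≥1 {i} is = let node (1≤o , o≤N) v∣o _ = nodes is in
      n≢0⇒n>0 λ v≡0 → >⇒≢ 1≤o (0∣⇒≡0 (subst (_∣ own i) v≡0 v∣o))

    traversal-start : ∀ {n A} → InRange N n → Traversal N n n A (N + 1)
    traversal-start {n} {A} r@(1≤n , n≤N) = traversal
      (inj₂ (is , heads r , +-monoˡ-≤ N (value-≥1 is)))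
      (min (inj₁ (+-comm N 1)) λ v → contradiction v unvisited)
      where
      is : IsNode f n
      is = 1≤n , ≤-<-trans n≤N N<f
      unvisited : ∀ {a} → ¬ Visited n n a
      unvisited (_ , _ , i , (1≤i , i<f) , o , _ , inj₁ refl) = contradiction 1≤n (λ ())
      -- A node numbered below `n` is the head of another list.
      unvisited (_ , _ , i , (1≤i , i<f) , o , _ , inj₂ i<n) =
        <⇒≢ i<n (trans (sym (heads (1≤i , ≤-trans (<⇒≤ i<n) n≤N))) o)

    link-position : ∀ {j n p q} → own p ≡ n → N < V p + suc j → Link f own V p q →
      Position j n q
    link-position _ _ (end _) = inj₁ refl
    link-position {j} {n} {p} o enough (step {q} p<q q<f same V< _) = inj₂
      ((≤-trans (s≤s z≤n) p<q , q<f) , trans same o ,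
       ≤-trans enough (≤-trans (≤-reflexive (+-suc (V p) j)) (+-monoˡ-≤ j V<)))

    -- The `NoneBetween` part of the link leaves `p` itself as the only node of this list passed
    -- over.
    link-visited : ∀ {n p q a} → IsNode f p → own p ≡ n → Link f own V p q →
      Visited n q a → Visited n p a ⊎ a ≡ V p
    link-visited {n} {p} {q} (1≤p , _) o link (1<a , a<n , i , is , oi , refl , before)
      with <-cmp i p
    ... | tri< i<p _ _  = inj₁ (1<a , a<n , i , is , oi , refl , inj₂ i<p)
    ... | tri≈ _ refl _ = inj₂ refl
    ... | tri> _ _ p<i  = ⊥-elim (absurd link before)
      where
      absurd : Link f own V p q → q ≡ 0 ⊎ i < q → _
      absurd (end none) _ = none i p<i (proj₂ is) (trans oi (sym o))
      absurd (step p<q _ _ _ _) (inj₁ refl) = contradiction p<q λ ()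
      absurd (step _ _ _ _ none) (inj₂ i<q) = none i p<i i<q (trans oi (sym o))

    -- Here `extend` also receives 1 < a < n, by which the branches that skip the divisors 1 and n
    -- discard the current node.
    traversal-step : ∀ {j n p A P P′} → 1 ≤ p →
      (∀ {R : ℕ → Set} → (∀ {a} → R a → 1 < a × a < n) →
         (∀ {a} → R a → Visited n p a ⊎ a ≡ V p) →
         Min A n (Visited n p) (quotient n) P → Min A n R (quotient n) P′) →
      Traversal (suc j) n p A P → Traversal j n (X p) A P′
    traversal-step 1≤p extend (traversal (inj₁ refl) _) = contradiction 1≤p λ ()
    traversal-step 1≤p extend (traversal (inj₂ (is , o , enough)) minimum) = traversal
      (link-position o enough (Node.link (nodes is)))
      (extend (λ { (1<a , a<n , _) → 1<a , a<n }) (link-visited is o (Node.link (nodes is)))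
              minimum)

    traversal-done : ∀ {j n A P} → InRange N n → Traversal j n 0 A P → Products n A P
    traversal-done r (traversal _ minimum) = min-⊆ visited minimum
      where
      visited : ∀ {a} → 1 < a × a < _ × a ∣ _ → Visited _ 0 a
      visited (1<a , a<n , a∣n) with entries r a∣n
      ... | i , is , o , v = 1<a , a<n , i , is , o , v , inj₁ refl

-- Named states and arithmetic of time bounds.

-- `f` stands for `free`, and `A V X L` for the arrays `compl`, `val`, `next` and `lastOf`.
pattern st N n k m d p f S P c A V X L =
  state (N ∷ n ∷ k ∷ m ∷ d ∷ p ∷ f ∷ S ∷ P ∷ c ∷ []) (A ∷ V ∷ X ∷ L ∷ [])

loop-≤ : ∀ {M j t t′} → j ≤ M → t′ ≤ t → j * t + t′ ≤ t * suc M
loop-≤ {M} {j} {t} {t′} j≤M t′≤t = begin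
  j * t + t′   ≤⟨ +-mono-≤ (*-monoˡ-≤ t j≤M) t′≤t ⟩
  M * t + t    ≡⟨ +-comm (M * t) t ⟩
  suc M * t    ≡⟨ *-comm (suc M) t ⟩
  t * suc M    ∎
  where open ≤-Reasoning

constant-≤ : ∀ {M} c → 1 ≤ M → c ≤ c * M
constant-≤ c 1≤M = ≤-trans (≤-reflexive (sym (*-identityʳ c))) (*-monoʳ-≤ c 1≤M)

sum-≤ : ∀ {M x y} a b → x ≤ a * M → y ≤ b * M → x + y ≤ (a + b) * M
sum-≤ {M} a b x≤ y≤ = ≤-trans (+-mono-≤ x≤ y≤) (≤-reflexive (sym (*-distribʳ-+ M a b)))

loop-≤² : ∀ {M j t t′} a → j ≤ M → t′ ≤ t → t ≤ a * suc M →
  j * t + t′ ≤ a * (suc M * suc M)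
loop-≤² {M} a j≤M t′≤t t≤ = ≤-trans (loop-≤ j≤M t′≤t)
  (≤-trans (*-monoˡ-≤ (suc M) t≤) (≤-reflexive (*-assoc a (suc M) (suc M))))

-- Verification of the program.

-- The summand 2 covers N = 0, where `k` and `n` are still set to 2 and cell 1 of `compl` is
-- written.
module Program (N W : ℕ) (2+2N≤W : 2 + (N + N) ≤ W)
  (free≤W : suc (harmonicSum N (suc N)) ≤ W) where

  2≤W : 2 ≤ W
  2≤W = ≤-trans (m≤m+n 2 _) 2+2N≤W

  1≤W : 1 ≤ W
  1≤W = ≤-trans (n≤1+n 1) 2≤W

  2N≤W : N + N ≤ W
  2N≤W = ≤-trans (m≤n+m _ 2) 2+2N≤W

  1+N≤W : suc N ≤ W
  1+N≤W = ≤-trans (s≤s (≤-trans (m≤m+n N N) (n≤1+n _))) 2+2N≤W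

  ≤N⇒≤W : ∀ {x} → x ≤ N → x ≤ W
  ≤N⇒≤W x≤N = ≤-trans (m≤n⇒m≤1+n x≤N) 1+N≤W

  ≤N⇒<W : ∀ {x} → x ≤ N → x < W
  ≤N⇒<W x≤N = ≤-trans (s≤s x≤N) 1+N≤W

  ≤N⇒+1≤W : ∀ {x} → x ≤ N → x + 1 ≤ W
  ≤N⇒+1≤W {x} x≤N rewrite +-comm x 1 = ≤N⇒<W x≤N

  open Logic W 1≤W
  open DivisorLists N
  open BruteForce using (startLists; buildDivisorLists; computeS; computeP; computeComplexities)

  1≤1+N : 1 ≤ suc N
  1≤1+N = s≤s z≤n

  1≤square : 1 ≤ suc N * suc N
  1≤square = s≤s z≤n

  StartLoop : ℕ → State → Set
  StartLoop j (st N′ n k m d p f S P c A V X L) =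
    N′ ≡ N × Starting j n (cell V) (cell X) (cell L)

  StartExit : State → Set
  StartExit (st N′ n k m d p f S P c A V X L) =
    N′ ≡ N × Building (suc N) 2 2 (cell V) (cell X) (cell L)

  Started : State → Set
  Started (st N′ n k m d p f S P c A V X L) =
    N′ ≡ N × f ≡ suc N × Building (suc N) 2 2 (cell V) (cell X) (cell L)

  startLists-runs : ∀ {n k m d p f S P c A V X L} →
    Run startLists (st N n k m d p f S P c A V X L) (17 * suc N) Started
  startLists-runs = within
    (seq (assign (λ _ → 1≤W)
      (while {t = 10} {Q = StartExit} StartLoop
        (λ { {j} {st _ n k m d p f S P c A V X L} (refl , inv) n≰N →
          refl , starting-done (≰⇒> n≰N) inv })
        (λ { {zero} {st _ n k m d p f S P c A V X L} (refl , inv) n≤N →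
               contradiction (subst (N <_) (+-identityʳ n) (Starting.enough inv)) (≤⇒≯ n≤N)
           ; {suc j} {st _ n k m d p f S P c A V X L} (refl , inv) n≤N →
               j , refl ,
               seq (write (λ _ → ≤N⇒<W n≤N) (λ _ → 1≤W)
               (seq (write (λ _ → ≤N⇒<W n≤N) (λ _ → z≤n)
               (seq (write (λ _ → ≤N⇒<W n≤N) (λ _ → ≤N⇒≤W n≤N)
               (assign (λ _ → ≤N⇒+1≤W n≤N) (refl , starting-step inv))))))) })
        N (refl , starting ≤-refl ≤-refl
             λ { {x} 1≤x x<1 → contradiction x<1 (≤⇒≯ 1≤x) })
       then λ { (st _ n k m d p f S P c A V X L) (refl , lists) →
         assign (λ _ → ≤N⇒+1≤W ≤-refl) (refl , +-comm N 1 , lists) })))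
    -- Each iteration takes 13 operations, 3 for the test and 10 for the body; the final test and
    -- the last assignment take 3 each.
    (sum-≤ {suc N} 1 16 (constant-≤ 1 1≤1+N)
      (sum-≤ {suc N} 13 3 (loop-≤ {N} {N} {13} {3} ≤-refl (≤ᵇ⇒≤ 3 13 tt)) (constant-≤ 3 1≤1+N)))

  OuterLoop : ℕ → State → Set
  OuterLoop j (st N′ n k m d p f S P c A V X L) =
    N′ ≡ N × Outer j k f (cell V) (cell X) (cell L)

  InnerLoop : ℕ → ℕ → State → Set
  InnerLoop o j (st N′ n k m d p f S P c A V X L) =
    N′ ≡ N × Inner o j k m f (cell V) (cell X) (cell L)

  InnerExit : ℕ → State → Set
  InnerExit o (st N′ n k m d p f S P c A V X L) =
    N′ ≡ N × k ≤ N × Outer o (k + 1) f (cell V) (cell X) (cell L)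

  DivisorsReady : State → Set
  DivisorsReady (st N′ n k m d p f S P c A V X L) =
    N′ ≡ N × Built f (cell V) (cell X)

  inner-body : ∀ {o j n k m d p f S P c A V X L} →
    Inner o (suc j) k m f (cell V) (cell X) (cell L) → m ≤ N →
    Run (BruteForce.append-k-to-list-m ⨾ BruteForce.m ≔ ! BruteForce.m +ᵉ ! BruteForce.k)
      (st N n k m d p f S P c A V X L) 19 (InnerLoop o j)
  inner-body {j = j} {k = k} {m = m} {f = f} {L = L} inv m≤N =
    seq (seq (write (λ _ → f<W) (λ _ → ≤N⇒≤W k≤N)
    (seq (write (λ _ → f<W) (λ _ → z≤n)
    (seq (write (λ _ → <-trans l<f f<W) (λ _ → <⇒≤ f<W)
    (seq (write (λ _ → ≤N⇒<W m≤N) (λ _ → <⇒≤ f<W)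
    (assign (λ _ → subst (_≤ W) (+-comm 1 f) f<W)
    (assign (λ _ → ≤-trans (+-mono-≤ m≤N k≤N) 2N≤W) (refl , inner-step m≤N inv)))))))))))
    where
    open Inner inv
    -- The fuel is a successor here, so the budget `free-≤` has room for one more node.
    f<W : f < W
    f<W = ≤-trans (s≤s (m≤m+n f j)) (≤-trans (≤-reflexive (sym (+-suc f j)))
      (≤-trans free-≤ (≤-trans (s≤s (harmonicSum-mono N (s≤s k≤N))) free≤W)))
    l<f : cell L m < f
    l<f = proj₂ (Last.is-node (Building.lasts lists (1≤m , m≤N)))

  -- Counting N iterations for each `k`, instead of ⌊N / k⌋, already gives order N².
  buildDivisorLists-runs : Run buildDivisorLists (initial N) (48 * (suc N * suc N)) DivisorsReady
  buildDivisorLists-runs = within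
    (startLists-runs then λ { (st _ n k m d p f S P c A V X L) (refl , refl , lists) →
      seq (assign (λ _ → 2≤W)
        (while {t = 27 * suc N} OuterLoop
          (λ { {j} {st _ n k m d p f S P c A V X L} (refl , inv) k≰N →
            refl , building-done (≰⇒> k≰N) (Outer.lists inv) })
          (λ { {zero} {st _ n k m d p f S P c A V X L} (refl , inv) k≤N →
                 contradiction (subst (N <_) (+-identityʳ k) (Outer.enough inv)) (≤⇒≯ k≤N)
             ; {suc o} {st _ n k m d p f S P c A V X L} (refl , inv) k≤N →
                 o , refl , outer-body inv k≤N })
          -- The N head nodes, which hold the divisor 1, account for the term k = 1 of the harmonic
          -- sum.
          N (refl , outer ≤-refl (s≤s (n≤1+n N)) (s≤s (≤-reflexive (sym (n/1≡n N)))) lists))) })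
    (sum-≤ {suc N * suc N} 17 31 (*-monoʳ-≤ 17 (m≤m*n (suc N) (suc N)))
      (sum-≤ {suc N * suc N} 1 30 (constant-≤ 1 1≤square)
        (loop-≤² {N} {N} {3 + 27 * suc N} {3} 30 ≤-refl (m≤m+n 3 _) (sum-≤ {suc N} 3 27 (constant-≤ 3 1≤1+N) ≤-refl))))
    where
    outer-body : ∀ {o n k m d p f S P c A V X L} →
      Outer (suc o) k f (cell V) (cell X) (cell L) → k ≤ N →
      Run _ (st N n k m d p f S P c A V X L) (27 * suc N) (OuterLoop o)
    outer-body {o} {k = k} inv k≤N = within
      (seq (assign (λ _ → ≤N⇒≤W k≤N)
        (while {t = 19} {Q = InnerExit o} (InnerLoop o)
          (λ { {j} {st _ n k m d p f S P c A V X L} (refl , inv) m≰N →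
            refl , Inner.k≤N inv , inner-done (≰⇒> m≰N) inv })
          (λ { {zero} {st _ n k m d p f S P c A V X L} (refl , inv) m≤N →
                 contradiction (subst (N <_) (+-identityʳ m) (Inner.enough inv)) (≤⇒≯ m≤N)
             ; {suc j} {st _ n k m d p f S P c A V X L} (refl , inv) m≤N →
                 j , refl , inner-body inv m≤N })
          (quotient N k) (refl , inner-start k≤N inv)
         then λ { (st _ n k m d p f S P c A V X L) (refl , k≤N , inv) →
           assign (λ _ → ≤N⇒+1≤W k≤N) (refl , inv) })))
      (sum-≤ {suc N} 2 25 (constant-≤ 2 1≤1+N)
        (sum-≤ {suc N} 22 3 (loop-≤ {N} {quotient N k} {22} {3} (quotient-≤ N k) (≤ᵇ⇒≤ 3 22 tt)) (constant-≤ 3 1≤1+N)))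

  SumLoop : ℕ → ℕ → State → Set
  SumLoop o j (st N′ n k m d p f S P c A V X L) =
    N′ ≡ N × Ready o n f (cell A) (cell V) (cell X) × Summing j k n (cell A) S

  SumsDone : ℕ → State → Set
  SumsDone o (st N′ n k m d p f S P c A V X L) =
    N′ ≡ N × Ready o n f (cell A) (cell V) (cell X) × Sums n (cell A) S

  computeS-runs : ∀ {o n k m d p f S P c A V X L} →
    Ready o n f (cell A) (cell V) (cell X) →
    Run computeS (st N n k m d p f S P c A V X L) (30 * suc N) (SumsDone o)
  computeS-runs {o} r = within
    (seq (assign (λ _ → ≤N⇒+1≤W ≤-refl)
    (seq (assign (λ _ → 1≤W)
      (while {t = 22} (SumLoop o)
        (λ { {j} {st _ n k m d p f S P c A V X L} (refl , r , inv) k≰n/2 →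
          refl , r , summing-done (≰⇒> k≰n/2) inv })
        (λ { {zero} {st _ n k m d p f S P c A V X L} (refl , r , inv) k≤n/2 →
               contradiction (subst (n / 2 <_) (+-identityʳ k) (Summing.enough inv))
                             (≤⇒≯ k≤n/2)
           ; {suc j} {st _ n k m d p f S P c A V X L} (refl , r , inv) k≤n/2 →
               j , refl , sum-body r inv k≤n/2 })
        N (refl , r , summing-start (Ready.n≤N r)))))))
    (sum-≤ {suc N} 3 27 (constant-≤ 3 1≤1+N)
      (sum-≤ {suc N} 1 26 (constant-≤ 1 1≤1+N)
        (loop-≤ {N} {N} {26} {4} ≤-refl (≤ᵇ⇒≤ 4 26 tt))))
    where
    sum-body : ∀ {o j n k m d p f S P c A V X L} →
      Ready o n f (cell A) (cell V) (cell X) → Summing (suc j) k n (cell A) S → k ≤ n / 2 →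
      Run _ (st N n k m d p f S P c A V X L) 22 (SumLoop o j)
    sum-body {n = n} {k} {A = A} r inv k≤n/2 = within
      (seq (assign (λ _ → sum≤W)
      (seq (cond
        (λ c≤S → assign (λ _ → sum≤W) (assign (λ _ → k+1≤W)
          (refl , r , summing-step (λ split → min-taken split cand c≤S) inv)))
        (λ c≰S → skip (assign (λ _ → k+1≤W)
          (refl , r , summing-step (λ split → min-kept split c≰S) inv)))))))
      (≤ᵇ⇒≤ _ 22 tt)
      where
      open Ready r
      cand : Candidate (cell A) n (cell A k + cell A (n ∸ k))
      cand = split-candidate r (Summing.1≤k inv) k≤n/2
      sum≤W : cell A k + cell A (n ∸ k) ≤ W
      sum≤W = ≤-trans (candidate-≤ r cand) 2N≤W
      k+1≤W : k + 1 ≤ W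
      k+1≤W = ≤N⇒+1≤W (≤-trans k≤n/2 (≤-trans (<⇒≤ n/2<n) n≤N))

  -- A dependent sum, because the traversal refers to the ownership function hidden in the lists of
  -- `r`.
  ProductLoop : ℕ → ℕ → State → Set
  ProductLoop o j (st N′ n k m d p f S P c A V X L) =
    N′ ≡ N × Sums n (cell A) S × Σ (Ready o n f (cell A) (cell V) (cell X)) λ r →
    Traversal (Ready.lists r) j n p (cell A) P

  ProductsDone : ℕ → State → Set
  ProductsDone o (st N′ n k m d p f S P c A V X L) =
    N′ ≡ N × Sums n (cell A) S × Ready o n f (cell A) (cell V) (cell X) ×
    Products n (cell A) P

  computeP-runs : ∀ {o n k m d p f S P c A V X L} →
    Ready o n f (cell A) (cell V) (cell X) → Sums n (cell A) S →
    Run computeP (st N n k m d p f S P c A V X L) (47 * suc N) (ProductsDone o)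
  computeP-runs {o} r sums = within
    (seq (assign (λ _ → ≤N⇒+1≤W ≤-refl)
    (seq (assign (λ _ → ≤N⇒≤W n≤N)
      (while {t = 40} (ProductLoop o)
        (λ { {j} {st _ n k m d zero f S P c A V X L} (refl , sums , r , inv) _ →
               refl , sums , r ,
               traversal-done (Ready.lists r) (Ready.1≤n r , Ready.n≤N r) inv
           ; {j} {st _ n k m d (suc p) f S P c A V X L} _ 1≰p →
               contradiction (s≤s z≤n) 1≰p })
        (λ { {zero} {st _ n k m d p f S P c A V X L} (refl , sums , r , inv) 1≤p →
               contradiction (Traversal.position inv) (exhausted (Ready.lists r) 1≤p)
           ; {suc j} {st _ n k m d p f S P c A V X L} (refl , sums , r , inv) 1≤p →
               j , refl , product-body sums r inv 1≤p })
        N (refl , sums , r , traversal-start lists (1≤n , n≤N)))))))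
    (sum-≤ {suc N} 3 44 (constant-≤ 3 1≤1+N)
      (sum-≤ {suc N} 2 42 (constant-≤ 2 1≤1+N)
        (loop-≤ {N} {N} {42} {2} ≤-refl (≤ᵇ⇒≤ 2 42 tt))))
    where
    open Ready r

    exhausted : ∀ {f V X n p} (lists : Built f V X) → 1 ≤ p → ¬ Position lists 0 n p
    exhausted lists 1≤p (inj₁ refl) = contradiction 1≤p λ ()
    exhausted {V = V} {p = p} lists 1≤p (inj₂ (is , _ , enough)) =
      <⇒≱ (subst (N <_) (+-identityʳ (V p)) enough) (divisor-≤N lists is)

    product-body : ∀ {o j n k m d p f S P c A V X L} → Sums n (cell A) S →
      (r : Ready o n f (cell A) (cell V) (cell X)) →
      Traversal (Ready.lists r) (suc j) n p (cell A) P → 1 ≤ p →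
      Run _ (st N n k m d p f S P c A V X L) 40 (ProductLoop o j)
    product-body {o} {j} {n} {p = p} {f} {S} {P} {A = A} {V} {X} sums r inv 1≤p = within
      (seq (assign (λ sm → proj₂ (lookup⁺ (proj₂ sm) (# 1)) p)
      (seq (cond
        (λ d≤1 → skip (advance (λ where
          bounds split → min-⊆ λ r → unlisted (λ { (1<d , _) → <⇒≱ 1<d d≤1 }) (bounds r) (split r))))
        (λ d≰1 → cond
          (λ n≤d → skip (advance (λ where
            bounds split → min-⊆ λ r → unlisted (λ { (_ , d<n) → <⇒≱ d<n n≤d }) (bounds r) (split r))))
          (λ n≰d → let cand = factor-candidate r (≰⇒> d≰1) (≰⇒> n≰d) d∣n
                       c≤W  = ≤-trans (candidate-≤ r cand) 2N≤W in
            seq (assign (λ _ → c≤W)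
            (cond
              (λ c≤P → assign (λ _ → c≤W) (advance λ _ split → min-taken split cand c≤P))
              (λ c≰P → skip (advance λ _ split → min-kept split c≰P))))))))))
      (≤ᵇ⇒≤ _ 40 tt)
      where
      d = cell V p

      d∣n : d ∣ n
      d∣n with Traversal.position inv
      ... | inj₁ refl = contradiction 1≤p λ ()
      ... | inj₂ (is , o , _) = subst (d ∣_) o (Node.divisor (Built.nodes (Ready.lists r) is))

      unlisted : ∀ {a} {B : Set} → ¬ (1 < d × d < n) → 1 < a × a < n → B ⊎ a ≡ d → B
      unlisted _ _ (inj₁ b) = b
      unlisted outside inside (inj₂ refl) = contradiction inside outside

      -- All four branches of the body end with this move and differ only in how the minimum is
      -- carried over.
      advance : ∀ {k m d′ P′ c L} →
        (∀ {R : ℕ → Set} → (∀ {a} → R a → 1 < a × a < n) →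
          (∀ {a} → R a → Visited (Ready.lists r) n p a ⊎ a ≡ d) →
          Min (cell A) n (Visited (Ready.lists r) n p) (quotient n) P →
          Min (cell A) n R (quotient n) P′) →
        Run (BruteForce.p ≔ BruteForce.next [ ! BruteForce.p ])
          (st N n k m d′ p f S P′ c A V X L) 3 (ProductLoop o j)
      advance extend = assign (λ sm → proj₂ (lookup⁺ (proj₂ sm) (# 2)) p)
        (refl , sums , r , traversal-step (Ready.lists r) 1≤p extend inv)

  MainLoop : ℕ → State → Set
  MainLoop j (st N′ n k m d p f S P c A V X L) =
    N′ ≡ N × 2 ≤ n × N < n + j × Built f (cell V) (cell X) × Table (cell A) n

  Correct : State → Set
  Correct s = ∀ n → 1 ≤ n → n ≤ N → ‖ n ‖≡ Compl s n

  computeComplexities-runs : ∀ {s} → DivisorsReady s →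
    Run computeComplexities s (95 * (suc N * suc N)) Correct
  computeComplexities-runs {st _ n k m d p f S P c A V X L} (refl , lists) = within
    (seq (write (λ _ → 2≤W) (λ _ → 1≤W)
    (seq (assign (λ _ → 2≤W)
      (while {t = 90 * suc N} MainLoop
        (λ { {j} {st _ n k m d p f S P c A V X L} (refl , _ , _ , _ , table) n≰N x 1≤x x≤N →
          table x 1≤x (≤-<-trans x≤N (≰⇒> n≰N)) })
        (λ { {zero} {st _ n k m d p f S P c A V X L} (refl , _ , enough , _) n≤N →
               contradiction (subst (N <_) (+-identityʳ n) enough) (≤⇒≯ n≤N)
           ; {suc o} {st _ n k m d p f S P c A V X L} (refl , 2≤n , enough , lists , table) n≤N →
               o , refl , main-body (ready 2≤n n≤N enough lists table) })
        N (refl , ≤-refl , s≤s (n≤1+n N) , lists , table-start (cell A)))))))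
    (sum-≤ {suc N * suc N} 1 94 (constant-≤ 1 1≤square)
      (sum-≤ {suc N * suc N} 1 93 (constant-≤ 1 1≤square)
        (loop-≤² {N} {N} {3 + 90 * suc N} {3} 93 ≤-refl (m≤m+n 3 _)
          (sum-≤ {suc N} 3 90 (constant-≤ 3 1≤1+N) ≤-refl))))
    where
    next-table : ∀ {o n f A V X v} → Ready o n f A V X → ‖ n ‖≡ v →
      N ≡ N × 2 ≤ n + 1 × N < n + 1 + o × Built f V X × Table (update n v A) (n + 1)
    next-table {o} {n} (ready 2≤n n≤N enough lists table) ‖n‖ rewrite +-comm n 1 =
      refl , m≤n⇒m≤1+n 2≤n , subst (N <_) (+-suc n o) enough , lists ,
      table-extend table ‖n‖

    main-body : ∀ {o n k m d p f S P c A V X L} →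
      Ready o n f (cell A) (cell V) (cell X) →
      Run _ (st N n k m d p f S P c A V X L) (90 * suc N) (MainLoop o)
    main-body {o} r = within
      (computeS-runs r then λ { (st _ n k m d p f S P c A V X L) (refl , r , sums) →
       computeP-runs r sums then λ { (st _ n k m d p f S P c A V X L) (refl , sums , r , products) →
       let open Ready r in
       seq (cond
         (λ S≤P → write (λ _ → ≤N⇒<W n≤N) (λ _ → ≤N⇒≤W (sum-≤N r sums))
           (assign (λ _ → ≤N⇒+1≤W n≤N)
             (next-table r (minimum-is-complexity r sums products ≤-refl S≤P (inj₁ refl)))))
         (λ S≰P → write (λ _ → ≤N⇒<W n≤N)
             (λ _ → ≤N⇒≤W (≤-trans (≰⇒≥ S≰P) (sum-≤N r sums)))
           (assign (λ _ → ≤N⇒+1≤W n≤N)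
             (next-table r (minimum-is-complexity r sums products (≰⇒≥ S≰P) ≤-refl (inj₂ refl)))))) } })
      -- 30 is for `computeS`, 47 for `computeP`, and 13 covers the final comparison, the write and
      -- the increment.
      (sum-≤ {suc N} 30 60 ≤-refl
        (sum-≤ {suc N} 47 13 ≤-refl
          (≤-trans (≤ᵇ⇒≤ _ 13 tt) (constant-≤ 13 1≤1+N))))

  small-initial : Small (initial N)
  small-initial =
    (≤N⇒≤W ≤-refl ∷ z≤n ∷ z≤n ∷ z≤n ∷ z≤n ∷ z≤n ∷ z≤n ∷ z≤n ∷ z≤n ∷ z≤n ∷ []) ,
    (empty ∷ empty ∷ empty ∷ empty ∷ [])
    where
    empty : SmallArray emptyArray
    empty = z≤n , λ _ → z≤n

  bruteForce-outcome : Outcome bruteForce (initial N) (143 * (suc N * suc N)) Correct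
  bruteForce-outcome = from-small
    (within (buildDivisorLists-runs then λ _ → computeComplexities-runs)
      (sum-≤ {suc N * suc N} 48 95 ≤-refl ≤-refl))
    small-initial

-- Asymptotic estimates and conclusion.

-- The two largest values are m ≤ 2 N on leaving its loop and the number of
-- nodes, a harmonic sum.
wordBound : ℕ → ℕ
wordBound N = 2 + (N + N) + suc ⌊log₂ N ⌋ * N

module BruteForceRun (N : ℕ) where

  harmonic-≤ : suc (harmonicSum N (suc N)) ≤ wordBound N
  harmonic-≤ = +-mono-≤ {1} {2 + (N + N)} (s≤s z≤n) (harmonicSum-log N)

  open Program N (wordBound N) (m≤m+n (2 + (N + N)) _) harmonic-≤ using (bruteForce-outcome)
  open Logic.Outcome bruteForce-outcome public

-- The logarithm is at least 1 from N = 2 on, so each of the five summands 2, N, N, N and N log N is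
-- at most N log N.
wordBound-≤ : ∀ N → 2 ≤ N → wordBound N ≤ 5 * (N * ⌊log₂ N ⌋)
wordBound-≤ N 2≤N = begin
  2 + (N + N) + (N + L * N)
    ≤⟨ +-mono-≤ (+-mono-≤ (≤-trans 2≤N N≤NL) (+-mono-≤ N≤NL N≤NL))
                (+-mono-≤ N≤NL (≤-reflexive (*-comm L N))) ⟩
  NL + (NL + NL) + (NL + NL)
    ≡⟨ solve 1 (λ x → x :+ (x :+ x) :+ (x :+ x) := con 5 :* x) refl NL ⟩
  5 * NL ∎
  where
  open ≤-Reasoning
  open +-*-Solver
  L NL : ℕ
  L  = ⌊log₂ N ⌋
  NL = N * L
  N≤NL : N ≤ NL
  N≤NL = ≤-trans (≤-reflexive (sym (*-identityʳ N))) (*-monoʳ-≤ N (⌊log₂⌋-mono-≤ 2≤N))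

n≤2^n : ∀ n → n ≤ 2 ^ n
n≤2^n zero    = z≤n
n≤2^n (suc n) = +-mono-≤ (1≤2^ n) (≤-trans (n≤2^n n) (m≤m+n _ 0))

-- With L the logarithm of N, the crude estimates 35 ≤ 2^6, N < 2^(L + 1) and L ≤ 2^L give at most 8
-- + 2 L bits, and L ≥ 1 absorbs the 8.
wordBits-≤ : ∀ N → 2 ≤ N → wordBits (wordBound N) ≤ 10 * ⌊log₂ N ⌋
wordBits-≤ N 2≤N = begin
  suc ⌊log₂ 7 * wordBound N ⌋   ≤⟨ s≤s (⌊log₂⌋-mono-≤ 7W≤) ⟩
  suc ⌊log₂ 2 ^ (6 + (suc L + L)) ⌋ ≡⟨ cong suc (⌊log₂[2^n]⌋≡n (6 + (suc L + L))) ⟩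
  8 + (L + L)   ≤⟨ +-monoˡ-≤ (L + L) (*-monoʳ-≤ 8 1≤L) ⟩
  8 * L + (L + L) ≡⟨ solve 1 (λ x → con 8 :* x :+ (x :+ x) := con 10 :* x) refl L ⟩
  10 * L ∎
  where
  open ≤-Reasoning
  open +-*-Solver
  L : ℕ
  L = ⌊log₂ N ⌋
  1≤L : 1 ≤ L
  1≤L = ⌊log₂⌋-mono-≤ 2≤N
  7W≤ : 7 * wordBound N ≤ 2 ^ (6 + (suc L + L))
  7W≤ = begin
    7 * wordBound N         ≤⟨ *-monoʳ-≤ 7 (wordBound-≤ N 2≤N) ⟩
    7 * (5 * (N * L))       ≡⟨ sym (*-assoc 7 5 (N * L)) ⟩
    35 * (N * L)            ≤⟨ *-mono-≤ (≤ᵇ⇒≤ 35 64 tt)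
                                 (*-mono-≤ (<⇒≤ (n<2^[1+log] N)) (n≤2^n L)) ⟩
    2 ^ 6 * (2 ^ suc L * 2 ^ L) ≡⟨ cong (2 ^ 6 *_) (sym (^-distribˡ-+-* 2 (suc L) L)) ⟩
    2 ^ 6 * 2 ^ (suc L + L) ≡⟨ sym (^-distribˡ-+-* 2 6 (suc L + L)) ⟩
    2 ^ (6 + (suc L + L))   ∎

-- The 24 words for variables and scratch are at most 12 W since W ≥ 2. This makes 16 W words, and
-- 800 = 16 * 5 * 10 by the two preceding estimates.
spaceBound-≤ : ∀ N → 2 ≤ N → spaceBound (wordBound N) ≤ 800 * (N * ⌊log₂ N ⌋ ^ 2)
spaceBound-≤ N 2≤N = begin
  10 * b + 4 * (W * b) + 14 * b
    ≡⟨ solve 2 (λ w x → con 10 :* x :+ con 4 :* (w :* x) :+ con 14 :* x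
                        := (con 24 :+ con 4 :* w) :* x) refl W b ⟩
  (24 + 4 * W) * b
    ≤⟨ *-mono-≤ (+-monoˡ-≤ (4 * W) (*-monoʳ-≤ 12 {2} {W} (s≤s (s≤s z≤n)))) (wordBits-≤ N 2≤N) ⟩
  (12 * W + 4 * W) * (10 * L)
    ≤⟨ *-monoˡ-≤ (10 * L) (+-mono-≤ (*-monoʳ-≤ 12 (wordBound-≤ N 2≤N))
                                    (*-monoʳ-≤ 4 (wordBound-≤ N 2≤N))) ⟩
  (12 * (5 * (N * L)) + 4 * (5 * (N * L))) * (10 * L)
    ≡⟨ solve 2 (λ n l → (con 12 :* (con 5 :* (n :* l)) :+ con 4 :* (con 5 :* (n :* l))) :* (con 10 :* l)
                        := con 800 :* (n :* (l :* (l :* con 1)))) refl N L ⟩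
  800 * (N * L ^ 2) ∎
  where
  open ≤-Reasoning
  open +-*-Solver
  L W b : ℕ
  L = ⌊log₂ N ⌋
  W = wordBound N
  b = wordBits W

[1+N]²-≤ : ∀ N → 1 ≤ N → suc N * suc N ≤ 4 * N ^ 2
[1+N]²-≤ N 1≤N = begin
  suc N * suc N      ≤⟨ *-mono-≤ (+-monoˡ-≤ N 1≤N) (+-monoˡ-≤ N 1≤N) ⟩
  (N + N) * (N + N)  ≡⟨ solve 1 (λ n → (n :+ n) :* (n :+ n) := con 4 :* (n :* (n :* con 1))) refl N ⟩
  4 * N ^ 2          ∎
  where
  open ≤-Reasoning
  open +-*-Solver

proposition1 : ∃[ time ] ∃[ space ]
    (∀ N → ∃[ s ]
    ⟨ bruteForce , initial N ⟩⇓⟨ s , time N , space N ⟩ ×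
    (∀ n → 1 ≤ n → n ≤ N → ‖ n ‖≡ Compl s n)) ×
    time ∈O (λ N → N ^ 2) ×
    space ∈O (λ N → N * ⌊log₂ N ⌋ ^ 2)
proposition1 =
  time , space , (λ N → final N , derivation N , post N) ,
  -- 572 = 143 * 4, since (N + 1)² ≤ 4 N² from N = 1 on.
  (572 , 1 , λ N 1≤N → ≤-trans (time-≤ N)
    (≤-trans (*-monoʳ-≤ 143 ([1+N]²-≤ N 1≤N)) (≤-reflexive (sym (*-assoc 143 4 (N ^ 2)))))) ,
  -- The threshold is 2 because the logarithm vanishes at N = 1, while the space never does.
  (800 , 2 , λ N 2≤N → ≤-trans (space-≤ N) (spaceBound-≤ N 2≤N))
  where open BruteForceRun
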